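{- For every integer $n\ge0$, $$c\phi_{10}(2n+1)\equiv0\pmod4,\qquad c\phi_{10}(5n+r)\equiv0\pmod{5^2}\ \ (1\le r\le4),\qquad c\phi_{10}(25n+15)\equiv0\pmod5.$$
   Context: A $k$-colored generalized Frobenius symbol is a two-row array with $d\ge 0$ columns whose entries are colored nonnegative integers $\ell_c$ ($\ell\ge 0$, color $c\in\{1,\dots,k\}$), each row strictly decreasing with respect to the total order $0_1\prec 0_2\prec\cdots\prec 0_k\prec 1_1\prec\cdots\prec 1_k\prec 2_1\prec\cdots$. It is a $k$-colored generalized Frobenius partition of $n=d+\sum(\text{integer values of all entries})$, and $c\phi_k(n)$ is the number of such partitions of $n$. -}

module Defs where

open import Data.Nat using (ℕ; _+_; _<_)
open import Data.Fin using (Fin; toℕ)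
open import Data.Product using (Σ; _×_; _,_; proj₁)
open import Data.Sum using (_⊎_)
open import Data.List using (List; length; map)
open import Data.Nat.ListAction using (sum)
open import Data.List.Relation.Unary.Linked using (Linked)
open import Function.Bundles using (_↔_)
open import Relation.Binary.PropositionalEquality using (_≡_)

-- A colored nonnegative integer ℓ_c : value ℓ ≥ 0 and color c ∈ Fin k
-- (color c ∈ {1,…,k} is represented by Fin k, i.e. index c-1).
Colored : ℕ → Set
Colored k = ℕ × Fin k

value : ∀ {k} → Colored k → ℕ
value = proj₁

_≺_ : ∀ {k} → Colored k → Colored k → Set
(ℓ , c) ≺ (ℓ' , c') = (ℓ < ℓ') ⊎ ((ℓ ≡ ℓ') × (toℕ c < toℕ c'))

StrictlyDecreasing : ∀ {k} → List (Colored k) → Set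
StrictlyDecreasing = Linked (λ x y → y ≺ x)

record FrobeniusSymbol (k : ℕ) : Set where
  field
    top    : List (Colored k)
    bottom : List (Colored k)
    top-dec    : StrictlyDecreasing top
    bottom-dec : StrictlyDecreasing bottom
    same-length : length top ≡ length bottom

weight : ∀ {k} → FrobeniusSymbol k → ℕ
weight s = length top + (sum (map value top) + sum (map value bottom))
  where open FrobeniusSymbol s

CFP : ℕ → ℕ → Set
CFP k n = Σ (FrobeniusSymbol k) (λ s → weight s ≡ n)

cφ≡ : ℕ → ℕ → ℕ → Set
cφ≡ k n m = Fin m ↔ CFP k n

{-# OPTIONS --safe #-}
module Submission where

-- Let F(z) = ∏_{i≥1} (1 + z q^i) ∏_{i≥0} (1 + z⁻¹ q^i); then cφ_k(n) is the coefficient of z⁰qⁿ in F^k.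
-- For p = 2, 5 one has q d/dq F¹⁰ = 10 H, where H is a sum of terms y (1 + y)⁹ G with y = z^{±1} q^i and,
-- modulo p, G a series in z^p and q^p. Modulo p this makes y (1 + y)⁹ G a sum of monomials y^j with
-- 1 ≤ j ≤ p times such a series, and a power y^j of charge divisible by p has weight divisible by p.
-- Hence p ∣ [z⁰qⁿ] H and p² ∣ n cφ₁₀(n) when p ∤ n.
-- Modulo 5, F(z, q)¹⁰ ≡ F(z⁵, q⁵)², so cφ₁₀(25n + 15) ≡ cφ₂(5n + 3). With E = ∏ (1 - q^i), the triple
-- product E F = Σ z^c q^{c(c+1)/2} and Jacobi's formula for E³ give E⁵ F² in charge 0 as
-- Σ_{c≥0,k} (-1)^c (2c + 1) q^{c(c+1)/2 + k²}. An exponent ≡ 3 (mod 5) means (2c + 1)² + 8k² ≡ 0, which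
-- forces 5 ∣ 2c + 1; and E⁵ ≡ E(q⁵) can be cancelled.

open import Defs

-- Series are arbitrary functions on ℤ × ℤ and two of them are never multiplied: only finite lists
-- of binomials act, each adding to a coefficient a signed coefficient at another point. The
-- infinite products are truncated at `N`, which is exact at weights below `N`. A binomial never
-- reads a higher weight, so the bound `w < + N` survives every multiplication and no limit is
-- taken. The exponent of E⁵ is 3 + 1 + 1: one E turns each of the two factors F into a theta
-- series, and three are left for Jacobi's formula, whose coefficients 2c + 1 supply the 5. That the
-- exponent is also the modulus is what makes the cancellation possible inside a single residue
-- class of weights, without knowing anything about the other classes. The 15 is 5 · 3, where 3 is
-- the solution of 8n + 1 ≡ 0 (mod 5): for it, completing the square leaves no constant term, and
-- the form x² + 8y² is anisotropic modulo 5.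

module LaurentSeries where

  open import Data.Integer using (ℤ; +_; -[1+_]; 0ℤ; 1ℤ; -1ℤ; _+_; _*_; _-_; -_; _<_; _≤_; +<+)
  import Data.Integer as ℤ
  import Data.Integer.Properties as ℤ
  open import Data.Integer.Divisibility.Signed
  open import Data.Integer.DivMod using (_%ℕ_; _/ℕ_; n%ℕd<d; a≡a%ℕn+[a/ℕn]*n)
  open import Data.Integer.Tactic.RingSolver using (solve-∀)
  open import Data.Nat using (ℕ; zero; suc)
  import Data.Nat as ℕ
  import Data.Nat.Divisibility as ℕ
  import Data.Nat.Properties as ℕ
  open import Data.Nat.ListAction using (sum)
  open import Data.Nat.Primality using (Prime; prime?; euclidsLemma; prime⇒nonZero)
  open import Data.Fin as Fin using (Fin; toℕ; fromℕ<; opposite)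
  import Data.Fin.Properties as Fin
  open import Data.Empty using (⊥-elim)
  open import Data.Product using (Σ; _×_; _,_; proj₁; proj₂)
  open import Data.Sum using (_⊎_; inj₁; inj₂)
  open import Data.Sum.Function.Propositional using (_⊎-↔_)
  open import Data.List using (List; []; _∷_; _++_; replicate; length; map; tabulate)
  open import Data.List.Properties using (map-++; map-tabulate; ++-assoc; ∷-injectiveʳ)
  open import Data.List.Membership.Propositional using (_∈_)
  open import Data.List.Membership.Propositional.Properties using (∈-tabulate⁺; ∈-tabulate⁻; ∈-++⁺ˡ; ∈-++⁺ʳ)
  open import Data.List.Relation.Binary.Permutation.Propositional using (_↭_; refl; prep; swap; trans; ↭-trans)
  open import Data.List.Relation.Binary.Permutation.Propositional.Properties using (shift; shifts; ++⁺ˡ; ++-comm)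
  open import Data.List.Relation.Binary.Sublist.Propositional using (_⊆_; []; _∷_; _∷ʳ_)
  open import Data.List.Relation.Unary.All as All using (All; []; _∷_)
  open import Data.List.Relation.Unary.All.Properties using (++⁺)
  open import Data.List.Relation.Unary.AllPairs using (AllPairs; []; _∷_)
  import Data.List.Relation.Unary.AllPairs.Properties as AllPairs
  open import Data.List.Relation.Unary.Any using (here; there)
  import Data.List.Relation.Unary.Linked as Linked
  open import Data.List.Relation.Unary.Linked.Properties using (Linked⇒AllPairs; AllPairs⇒Linked)
  open import Axiom.UniquenessOfIdentityProofs using (module Decidable⇒UIP)
  open import Function using (_∘_)
  open import Function.Bundles using (_↔_; mk↔ₛ′; mk⤖)
  open import Function.Construct.Composition using (_↔-∘_)
  open import Function.Properties.Bijection using (⤖⇒↔)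
  open import Relation.Binary.Definitions using (Irrelevant)
  open import Relation.Binary.PropositionalEquality hiding (trans; [_])
  open import Relation.Binary.PropositionalEquality using () renaming (trans to ≡-trans)
  open import Relation.Nullary using (¬_; yes; no)
  open import Relation.Nullary.Decidable using (from-yes; _→-dec_)

  -- Laurent series and products of binomials

  Point : Set
  Point = ℤ × ℤ

  -- Laurent series in z and q: f (c , w) is the coefficient of z^c q^w.
  Series : Set
  Series = Point → ℤ

  -- The binomials 1 + z q^i, 1 + z⁻¹ q^i and 1 - q^i.
  data Atom : Set where
    top bot eul : ℕ → Atom

  sgn : Atom → ℤ
  sgn (top i) = 1ℤ
  sgn (bot i) = 1ℤ
  sgn (eul i) = -1ℤ

  wt : Atom → ℕ
  wt (top i) = i
  wt (bot i) = i
  wt (eul i) = i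

  -- The charge that multiplication reads from: a factor z moves the coefficient at c - 1 to c,
  -- hence the reversed signs.
  ch : Atom → ℤ → ℤ
  ch (top i) c = c - 1ℤ
  ch (bot i) c = c + 1ℤ
  ch (eul i) c = c

  drop : Atom → Point → Point
  drop a (c , w) = ch a c , w - + wt a

  -- Opaque because ten nested steps would unfold to 2¹⁰ terms.
  opaque
    step : Atom → Series → Series
    step a f x = f x + sgn a * f (drop a x)

  act : List Atom → Series → Series
  act []       f = f
  act (a ∷ as) f = step a (act as f)

  sub-comm : ∀ w i j → w - i - j ≡ w - j - i
  sub-comm = solve-∀

  pred-suc : ∀ c → c + 1ℤ - 1ℤ ≡ c - 1ℤ + 1ℤ
  pred-suc = solve-∀

  ch-comm : ∀ a b c → ch a (ch b c) ≡ ch b (ch a c)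
  ch-comm (top _) (top _) c = refl
  ch-comm (top _) (bot _) c = pred-suc c
  ch-comm (bot _) (top _) c = sym (pred-suc c)
  ch-comm (bot _) (bot _) c = refl
  ch-comm (eul _) _       c = refl
  ch-comm (top _) (eul _) c = refl
  ch-comm (bot _) (eul _) c = refl

  drop-comm : ∀ a b x → drop a (drop b x) ≡ drop b (drop a x)
  drop-comm a b (c , w) = cong₂ _,_ (ch-comm a b c) (sub-comm w (+ wt b) (+ wt a))

  opaque
    unfolding step

    step-cong : ∀ a {f g} → (∀ x → f x ≡ g x) → ∀ x → step a f x ≡ step a g x
    step-cong a e x = cong₂ (λ u v → u + sgn a * v) (e x) (e (drop a x))

  step-comm-ring : ∀ s t x y z u → x + t * y + s * (z + t * u) ≡ x + s * z + t * (y + s * u)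
  step-comm-ring = solve-∀

  opaque
    unfolding step

    step-comm : ∀ a b f x → step a (step b f) x ≡ step b (step a f) x
    step-comm a b f x
      rewrite drop-comm b a x =
      step-comm-ring (sgn a) (sgn b) (f x) (f (drop b x)) (f (drop a x)) (f (drop a (drop b x)))

  act-↭ : ∀ {as bs} f → as ↭ bs → ∀ x → act as f x ≡ act bs f x
  act-↭ f refl          x = refl
  act-↭ f (prep a p)    x = step-cong a (act-↭ f p) x
  act-↭ f (swap {xs} a b p) x =
    ≡-trans (step-comm a b (act xs f) x) (step-cong b (step-cong a (act-↭ f p)) x)
  act-↭ f (trans p q)   x = ≡-trans (act-↭ f p x) (act-↭ f q x)

  act-++ : ∀ as bs f x → act (as ++ bs) f x ≡ act as (act bs f) x
  act-++ []       bs f x = refl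
  act-++ (a ∷ as) bs f x = step-cong a (act-++ as bs f) x

  Closed : (Point → Point → Set) → Atom → Set
  Closed R a = ∀ {x y} → R x y → R (drop a x) (drop a y)

  opaque
    unfolding step

    -- A product reads `f` only at points reached by drops, so a relation closed under them is all
    -- that is needed. With equality plus a weight bound for `R`, truncated identities pass through
    -- a product; with the graph of a translation, products commute with it.
    act-transfer : ∀ (R : Point → Point → Set) {as f g} → All (Closed R) as →
                   (∀ {x y} → R x y → f x ≡ g y) → ∀ {x y} → R x y → act as f x ≡ act as g y
    act-transfer R []        e r = e r
    act-transfer R {a ∷ _} (p ∷ ps) e r =
      cong₂ (λ u v → u + sgn a * v) (act-transfer R ps e r) (act-transfer R ps e (p r))

  act-cong : ∀ as {f g} → (∀ x → f x ≡ g x) → ∀ x → act as f x ≡ act as g x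
  act-cong []       e x = e x
  act-cong (a ∷ as) e x = step-cong a (act-cong as e) x

  stepⁿ : ℕ → Atom → Series → Series
  stepⁿ zero    a f = f
  stepⁿ (suc n) a f = step a (stepⁿ n a f)

  dropⁿ : ℕ → Atom → Point → Point
  dropⁿ zero    a x = x
  dropⁿ (suc n) a x = drop a (dropⁿ n a x)

  power : ℕ → List Atom → List Atom
  power k []       = []
  power k (a ∷ as) = replicate k a ++ power k as

  -- (1 + s y)^p ≡ 1 + s y^p (mod p)
  Frobenius : ℕ → Set
  Frobenius p = ∀ a f x → + p ∣ stepⁿ p a f x - (f x + sgn a * f (dropⁿ p a x))

  binomial₂-ring : ∀ s x y z → x + s * y + s * (y + s * z) ≡ x + + 2 * s * y + s * s * z
  binomial₂-ring = solve-∀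

  opaque
    unfolding step

    binomial₂ : ∀ a f x → stepⁿ 2 a f x ≡ f x + + 2 * sgn a * f (dropⁿ 1 a x) + sgn a * sgn a * f (dropⁿ 2 a x)
    binomial₂ a f x = binomial₂-ring (sgn a) (f x) (f (dropⁿ 1 a x)) (f (dropⁿ 2 a x))

  -- For `eul` the square of the sign agrees with the sign only modulo 2, as 1 = -1 + 2; `k` carries
  -- that correction.
  sgn-square : ∀ a → Σ ℤ λ k → sgn a * sgn a ≡ sgn a + k * + 2
  sgn-square (top _) = 0ℤ , refl
  sgn-square (bot _) = 0ℤ , refl
  sgn-square (eul _) = 1ℤ , refl

  sgn-fifth : ∀ a → sgn a * sgn a * sgn a * sgn a * sgn a ≡ sgn a
  sgn-fifth (top _) = refl
  sgn-fifth (bot _) = refl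
  sgn-fifth (eul _) = refl

  frobenius₂-ring : ∀ s k x y z → x + + 2 * s * y + (s + k * + 2) * z - (x + s * z) ≡ (s * y + k * z) * + 2
  frobenius₂-ring = solve-∀

  frobenius₂ : Frobenius 2
  frobenius₂ a f x with sgn-square a
  ... | k , e = divides (s * f y + k * f z) (≡-trans
    (cong (_- (f x + s * f z)) (≡-trans (binomial₂ a f x) (cong (λ u → f x + + 2 * s * f y + u * f z) e)))
    (frobenius₂-ring s k (f x) (f y) (f z)))
    where
    s = sgn a
    y = dropⁿ 1 a x
    z = dropⁿ 2 a x

  frobenius₅-ring : ∀ s a b c d e f →
    let p = a + + 2 * s * b + s * s * c
        q = b + + 2 * s * c + s * s * d
        r = c + + 2 * s * d + s * s * e
        t = d + + 2 * s * e + s * s * f in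
    p + + 2 * s * q + s * s * r + s * (q + + 2 * s * r + s * s * t)
      - (a + s * s * s * s * s * f)
    ≡ (s * b + + 2 * s * s * c + + 2 * s * s * s * d + s * s * s * s * e) * + 5
  frobenius₅-ring = solve-∀

  opaque
    unfolding step

    frobenius₅ : Frobenius 5
    frobenius₅ a f x = divides
      (s * f (dropⁿ 1 a x) + + 2 * s * s * f (dropⁿ 2 a x) + + 2 * s * s * s * f (dropⁿ 3 a x)
        + s * s * s * s * f (dropⁿ 4 a x)) (≡-trans
      (cong₂ _-_ expand (cong (λ t → f x + t * f (dropⁿ 5 a x)) (sym (sgn-fifth a))))
      (frobenius₅-ring s (f x) (f (dropⁿ 1 a x)) (f (dropⁿ 2 a x)) (f (dropⁿ 3 a x))
         (f (dropⁿ 4 a x)) (f (dropⁿ 5 a x))))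
      where
      s : ℤ
      s = sgn a
      square : Series → Series
      square g x = g x + + 2 * s * g (dropⁿ 1 a x) + s * s * g (dropⁿ 2 a x)
      binomial₄ : ∀ x → stepⁿ 4 a f x ≡ square (square f) x
      binomial₄ x = ≡-trans (binomial₂ a (stepⁿ 2 a f) x)
        (cong₂ _+_ (cong₂ (λ u v → u + + 2 * s * v) (binomial₂ a f x) (binomial₂ a f (dropⁿ 1 a x)))
                   (cong (s * s *_) (binomial₂ a f (dropⁿ 2 a x))))
      expand : stepⁿ 5 a f x ≡ square (square f) x + s * square (square f) (drop a x)
      expand = cong₂ (λ u v → u + s * v) (binomial₄ x) (binomial₄ (drop a x))

  -- Series modulo 2 and 5

  δ₁ : ℤ → ℤ
  δ₁ (+ zero)  = 1ℤ
  δ₁ (+ suc _) = 0ℤ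
  δ₁ -[1+ _ ]  = 0ℤ

  δ : Series
  δ (c , w) = δ₁ c * δ₁ w

  Vanish : ℕ → (Point → Set) → Series → Set
  Vanish p Q f = ∀ x → Q x → + p ∣ f x

  sub-add : ∀ u v → u - v + v ≡ u
  sub-add = solve-∀

  ∣-diff : ∀ {p} u v → p ∣ u - v → p ∣ v → p ∣ u
  ∣-diff {p} u v d e = subst (p ∣_) (sub-add u v) (∣m∣n⇒∣m+n d e)

  -- Modulo p, the p-th power of a binomial reads only x and `dropⁿ p a x`, so a region closed under
  -- this single jump keeps its zeros.
  frobenius-vanish : ∀ {p} → Frobenius p → ∀ Q a f → (∀ x → Q x → Q (dropⁿ p a x)) →
                     Vanish p Q f → Vanish p Q (stepⁿ p a f)
  frobenius-vanish {p} frob Q a f closed van x q =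
    ∣-diff (stepⁿ p a f x) (f x + sgn a * f (dropⁿ p a x)) (frob a f x)
      (∣m∣n⇒∣m+n (van x q) (∣n⇒∣m*n (sgn a) (van (dropⁿ p a x) (closed x q))))

  -- Divisibility of charge and weight by p

  κ : Atom → ℤ
  κ (top _) = 1ℤ
  κ (bot _) = -1ℤ
  κ (eul _) = 0ℤ

  ch-κ : ∀ a c → ch a c ≡ c - κ a
  ch-κ (top _) c = refl
  ch-κ (bot _) c = refl
  ch-κ (eul _) c = sym (ℤ.+-identityʳ c)

  dropⁿ-zero-ring : ∀ c k → c ≡ c - 0ℤ * k
  dropⁿ-zero-ring = solve-∀

  dropⁿ-suc-ring : ∀ n c k → c - n * k - k ≡ c - (1ℤ + n) * k
  dropⁿ-suc-ring = solve-∀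

  dropⁿ-closed : ∀ n a c w → dropⁿ n a (c , w) ≡ (c - + n * κ a , w - + n * + wt a)
  dropⁿ-closed zero    a c w = cong₂ _,_ (dropⁿ-zero-ring c (κ a)) (dropⁿ-zero-ring w (+ wt a))
  dropⁿ-closed (suc n) a c w rewrite dropⁿ-closed n a c w = cong₂ _,_
    (≡-trans (ch-κ a (c - + n * κ a)) (dropⁿ-suc-ring (+ n) c (κ a)))
    (dropⁿ-suc-ring (+ n) w (+ wt a))

  dropⁿ-drop : ∀ n a x → dropⁿ n a (drop a x) ≡ dropⁿ (suc n) a x
  dropⁿ-drop zero    a x = refl
  dropⁿ-drop (suc n) a x = cong (drop a) (dropⁿ-drop n a x)

  Lattice : ℕ → Point → Set
  Lattice p (c , w) = + p ∣ c × + p ∣ w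

  OffLattice : ℕ → Point → Set
  OffLattice p x = ¬ Lattice p x

  -- Charge 0 with p ∤ n is the case of interest, but charge 0 alone is not stable under p-fold
  -- drops; charge divisible by p is.
  OffWeight : ℕ → Point → Set
  OffWeight p (c , w) = + p ∣ c × ¬ (+ p ∣ w)

  ∣-shift : ∀ {p} c k → p ∣ c - p * k → p ∣ c
  ∣-shift {p} c k d = ∣-diff c (p * k) d (∣m⇒∣m*n k ∣-refl)

  ∣-shift⁻ : ∀ {p} c k → p ∣ c → p ∣ c - p * k
  ∣-shift⁻ c k d = ∣m∣n⇒∣m-n d (∣m⇒∣m*n k ∣-refl)

  offLattice-closed : ∀ p a x → OffLattice p x → OffLattice p (dropⁿ p a x)
  offLattice-closed p a (c , w) q rewrite dropⁿ-closed p a c w =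
    λ (d , e) → q (∣-shift c (κ a) d , ∣-shift w (+ wt a) e)

  offWeight-closed : ∀ p a x → OffWeight p x → OffWeight p (dropⁿ p a x)
  offWeight-closed p a (c , w) (d , q) rewrite dropⁿ-closed p a c w =
    ∣-shift⁻ c (κ a) d , λ e → q (∣-shift w (+ wt a) e)

  opaque
    unfolding step

    stepⁿ-∣ : ∀ {p} n a f x → (∀ j → p ∣ f (dropⁿ j a x)) → p ∣ stepⁿ n a f x
    stepⁿ-∣ zero    a f x h = h 0
    stepⁿ-∣ (suc n) a f x h = ∣m∣n⇒∣m+n (stepⁿ-∣ n a f x h) (∣n⇒∣m*n (sgn a)
      (stepⁿ-∣ n a f (drop a x) λ j → subst (λ y → _ ∣ f y) (sym (dropⁿ-drop j a x)) (h (suc j))))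

  Charged : Atom → Set
  Charged a = κ a ≡ 1ℤ ⊎ κ a ≡ -1ℤ

  mul-neg-one : ∀ j → j ≡ - (j * -1ℤ)
  mul-neg-one = solve-∀

  charged-∣ : ∀ {p} a j → Charged a → p ∣ j * κ a → p ∣ j
  charged-∣ {p} a j (inj₁ e) d rewrite e = subst (p ∣_) (ℤ.*-identityʳ j) d
  charged-∣ {p} a j (inj₂ e) d rewrite e = subst (p ∣_) (sym (mul-neg-one j)) (∣m⇒∣-m d)

  sub-sub : ∀ c d → c - (c - d) ≡ d
  sub-sub = solve-∀

  -- As κ = ±1, reaching a charge divisible by p takes a multiple of p drops, and these change the
  -- weight by a multiple of p.
  offWeight-dropⁿ : ∀ p a → Charged a → ∀ x → OffWeight p x → ∀ j → OffLattice p (dropⁿ j a x)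
  offWeight-dropⁿ p a ca (c , w) (d , q) j rewrite dropⁿ-closed j a c w = λ (e , e') →
    let p∣j = charged-∣ a (+ j) ca (subst (+ p ∣_) (sub-sub c (+ j * κ a)) (∣m∣n⇒∣m-n d e))
    in q (∣-diff w (+ j * + wt a) e' (∣m⇒∣m*n (+ wt a) p∣j))

  δ-offLattice : ∀ p → Vanish p (OffLattice p) δ
  δ-offLattice p (+ zero  , + zero)  q with () ← q (divides 0ℤ refl , divides 0ℤ refl)
  δ-offLattice p (+ zero  , + suc w) q = divides 0ℤ refl
  δ-offLattice p (+ zero  , -[1+ w ]) q = divides 0ℤ refl
  δ-offLattice p (+ suc c , w) q = divides 0ℤ refl
  δ-offLattice p (-[1+ c ] , w) q = divides 0ℤ refl

  -- What is used of a prime divisor p of 10.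
  record Tenfold (p : ℕ) : Set₁ where
    field
      tenth : ∀ Q a f → (∀ x → Q x → Q (dropⁿ p a x)) → Vanish p Q f → Vanish p Q (stepⁿ 10 a f)
      ninth : ∀ a f → Charged a → Vanish p (OffLattice p) f →
              ∀ x → OffWeight p x → + p ∣ stepⁿ 9 a f (drop a x)

  tenfold₂ : Tenfold 2
  tenfold₂ = record
    { tenth = λ Q a f cl v → van Q a (stepⁿ 8 a f) cl (van Q a (stepⁿ 6 a f) cl
        (van Q a (stepⁿ 4 a f) cl (van Q a (stepⁿ 2 a f) cl (van Q a f cl v))))
    -- 9 = 1 + 8: the eight factors form squares and preserve vanishing off the lattice, and the
    -- factor left over reads only drops of x, all off the lattice. For p = 5 the split is 9 = 4 +
    -- 5.
    ; ninth = λ a f ca v x q → stepⁿ-∣ 1 a (stepⁿ 8 a f) (drop a x) λ j →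
        off a (stepⁿ 6 a f) (off a (stepⁿ 4 a f) (off a (stepⁿ 2 a f) (off a f v))) (dropⁿ j a (drop a x))
          (subst (OffLattice 2) (sym (dropⁿ-drop j a x)) (offWeight-dropⁿ 2 a ca x q (suc j)))
    }
    where
    van : ∀ Q a f → (∀ x → Q x → Q (dropⁿ 2 a x)) → Vanish 2 Q f → Vanish 2 Q (stepⁿ 2 a f)
    van = frobenius-vanish frobenius₂
    off : ∀ a f → Vanish 2 (OffLattice 2) f → Vanish 2 (OffLattice 2) (stepⁿ 2 a f)
    off a f = van (OffLattice 2) a f (offLattice-closed 2 a)

  tenfold₅ : Tenfold 5
  tenfold₅ = record
    { tenth = λ Q a f cl v → van Q a (stepⁿ 5 a f) cl (van Q a f cl v)
    ; ninth = λ a f ca v x q → stepⁿ-∣ 4 a (stepⁿ 5 a f) (drop a x) λ j →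
        van (OffLattice 5) a f (offLattice-closed 5 a) v (dropⁿ j a (drop a x))
          (subst (OffLattice 5) (sym (dropⁿ-drop j a x)) (offWeight-dropⁿ 5 a ca x q (suc j)))
    }
    where
    van : ∀ Q a f → (∀ x → Q x → Q (dropⁿ 5 a x)) → Vanish 5 Q f → Vanish 5 Q (stepⁿ 5 a f)
    van = frobenius-vanish frobenius₅

  -- The derivative q d/dq of a tenth power

  D : Series → Series
  D f x = proj₂ x * f x

  leibniz-zero-ring : ∀ w i s a b → w * (a + s * b) ≡ w * a + s * ((w - i) * b) + 1ℤ * (s * i) * b
  leibniz-zero-ring = solve-∀

  leibniz-suc-ring₁ : ∀ w i s a b → w * (a + s * b) ≡ w * a + s * ((w - i) * b) + s * i * b
  leibniz-suc-ring₁ = solve-∀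

  leibniz-suc-ring₂ : ∀ n i s a b g h →
    a + n * (s * i) * g + s * (b + n * (s * i) * h) + s * i * (g + s * h)
    ≡ a + s * b + (1ℤ + n) * (s * i) * (g + s * h)
  leibniz-suc-ring₂ = solve-∀

  opaque
    unfolding step

    -- The product rule for (1 + s y)^(n+1) f. The factor `suc n`, taken at n = 9, is the 10 of
    -- `D-power`.
    leibniz : ∀ n a f x → D (stepⁿ (suc n) a f) x ≡
              stepⁿ (suc n) a (D f) x + + suc n * (sgn a * + wt a) * stepⁿ n a f (drop a x)
    leibniz zero    a f x = leibniz-zero-ring (proj₂ x) (+ wt a) (sgn a) (f x) (f (drop a x))
    leibniz (suc n) a f x = ≡-trans
      (leibniz-suc-ring₁ (proj₂ x) (+ wt a) s (stepⁿ (suc n) a f x) (stepⁿ (suc n) a f y))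
      (≡-trans
        (cong₂ (λ u v → u + s * v + s * + wt a * stepⁿ (suc n) a f y)
           (leibniz n a f x) (leibniz n a f y))
        (leibniz-suc-ring₂ (+ suc n) (+ wt a) s (stepⁿ (suc n) a (D f) x) (stepⁿ (suc n) a (D f) y)
           (stepⁿ n a f y) (stepⁿ n a f (drop a y))))
      where
      s : ℤ
      s = sgn a
      y : Point
      y = drop a x

  scale-ring : ∀ k s a b → k * a + s * (k * b) ≡ k * (a + s * b)
  scale-ring = solve-∀

  opaque
    unfolding step

    stepⁿ-scale : ∀ n a k f x → stepⁿ n a (λ y → k * f y) x ≡ k * stepⁿ n a f x
    stepⁿ-scale zero    a k f x = refl
    stepⁿ-scale (suc n) a k f x = ≡-trans
      (cong₂ (λ u v → u + sgn a * v) (stepⁿ-scale n a k f x) (stepⁿ-scale n a k f (drop a x)))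
      (scale-ring k (sgn a) (stepⁿ n a f x) (stepⁿ n a f (drop a x)))

  stepⁿ-cong : ∀ n a {f g} → (∀ x → f x ≡ g x) → ∀ x → stepⁿ n a f x ≡ stepⁿ n a g x
  stepⁿ-cong zero    a e = e
  stepⁿ-cong (suc n) a e = step-cong a (stepⁿ-cong n a e)

  -- A tenth of the q-derivative of the tenth power of a product of binomials.
  H : List Atom → Series
  H []       x = 0ℤ
  H (a ∷ as) x = stepⁿ 10 a (H as) x + sgn a * + wt a * stepⁿ 9 a (act (power 10 as) δ) (drop a x)

  D-δ : ∀ x → D δ x ≡ + 10 * 0ℤ
  D-δ (c , + zero)  = refl
  D-δ (c , + suc w) rewrite ℤ.*-zeroʳ (δ₁ c) = ℤ.*-zeroʳ (+ suc w)
  D-δ (c , -[1+ w ]) rewrite ℤ.*-zeroʳ (δ₁ c) = ℤ.*-zeroʳ -[1+ w ]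

  H-ring : ∀ h s g → + 10 * h + + 10 * s * g ≡ + 10 * (h + s * g)
  H-ring = solve-∀

  D-power : ∀ as x → D (act (power 10 as) δ) x ≡ + 10 * H as x
  D-power []       x = D-δ x
  D-power (a ∷ as) x = ≡-trans (leibniz 9 a F x) (≡-trans
    (cong (_+ + 10 * (sgn a * + wt a) * stepⁿ 9 a F (drop a x))
      (≡-trans (stepⁿ-cong 10 a (D-power as) x) (stepⁿ-scale 10 a (+ 10) (H as) x)))
    (H-ring (stepⁿ 10 a (H as) x) (sgn a * + wt a) (stepⁿ 9 a F (drop a x))))
    where F = act (power 10 as) δ

  -- Ten equal factors group into p-th powers, so modulo p the product is a series in z^p and q^p.
  power-offLattice : ∀ {p} → Tenfold p → ∀ as → Vanish p (OffLattice p) (act (power 10 as) δ)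
  power-offLattice {p} t []       = δ-offLattice p
  power-offLattice {p} t (a ∷ as) =
    Tenfold.tenth t (OffLattice p) a (act (power 10 as) δ) (offLattice-closed p a) (power-offLattice t as)

  H-offWeight : ∀ {p} → Tenfold p → ∀ {as} → All Charged as → Vanish p (OffWeight p) (H as)
  H-offWeight t []               x q = divides 0ℤ refl
  H-offWeight {p} t {a ∷ as} (ca ∷ cas) x q = ∣m∣n⇒∣m+n
    (Tenfold.tenth t (OffWeight p) a (H as) (offWeight-closed p a) (H-offWeight t cas) x q)
    (∣n⇒∣m*n (sgn a * + wt a)
      (Tenfold.ninth t a (act (power 10 as) δ) ca (power-offLattice t as) x q))

  -- Tenth powers on the lattice 5ℤ × 5ℤ

  infixl 7 _•_
  _•_ : ℤ → Point → Point
  k • (c , w) = k * c , k * w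

  dilate-ring : ∀ c k → + 5 * c - + 5 * k ≡ + 5 * (c - k)
  dilate-ring = solve-∀

  dropⁿ-• : ∀ a x → dropⁿ 5 a (+ 5 • x) ≡ + 5 • drop a x
  dropⁿ-• a (c , w) = ≡-trans (dropⁿ-closed 5 a (+ 5 * c) (+ 5 * w))
    (cong₂ _,_ (≡-trans (dilate-ring c (κ a)) (cong (+ 5 *_) (sym (ch-κ a c)))) (dilate-ring w (+ wt a)))

  -- F ≡ f(z⁵, q⁵) modulo 5, tested on the lattice only: the weight 25n + 15 and charge 0 lie on it.
  Dilates : Series → Series → Set
  Dilates F f = ∀ x → + 5 ∣ F (+ 5 • x) - f x

  dilates-ring : ∀ s a b a' b' → a + s * b - (a' + s * b') ≡ a - a' + s * (b - b')
  dilates-ring = solve-∀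

  sub-trans : ∀ a b c → a - b + (b - c) ≡ a - c
  sub-trans = solve-∀

  opaque
    unfolding step

    dilates-step : ∀ a F f → Dilates F f → Dilates (stepⁿ 5 a F) (step a f)
    dilates-step a F f d x = subst (+ 5 ∣_) (sub-trans (stepⁿ 5 a F X) mid (step a f x))
      (∣m∣n⇒∣m+n (frobenius₅ a F X)
        (subst (+ 5 ∣_) (sym (dilates-ring (sgn a) (F X) (F (dropⁿ 5 a X)) (f x) (f (drop a x))))
          (∣m∣n⇒∣m+n (d x) (∣n⇒∣m*n (sgn a)
            (subst (λ y → + 5 ∣ F y - f (drop a x)) (sym (dropⁿ-• a x)) (d (drop a x)))))))
      where
      X : Point
      X = + 5 • x
      mid : ℤ
      mid = F X + sgn a * F (dropⁿ 5 a X)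

  δ-dilates : Dilates δ δ
  δ-dilates (+ zero  , + zero)   = divides 0ℤ refl
  δ-dilates (+ zero  , + suc w)  = divides 0ℤ refl
  δ-dilates (+ zero  , -[1+ w ]) = divides 0ℤ refl
  δ-dilates (+ suc c , w)        = divides 0ℤ refl
  δ-dilates (-[1+ c ] , w)       = divides 0ℤ refl

  power-dilates : ∀ as → Dilates (act (power 10 as) δ) (act (power 2 as) δ)
  power-dilates []       = δ-dilates
  power-dilates (a ∷ as) =
    dilates-step a (stepⁿ 5 a F) (step a f) (dilates-step a F f (power-dilates as))
    where
    F = act (power 10 as) δ
    f = act (power 2 as) δ

  -- The Jacobi triple product

  opaque
    unfolding step

    step-def : ∀ a f x → step a f x ≡ f x + sgn a * f (drop a x)
    step-def a f x = refl

  step-top : ∀ i f c w → step (top i) f (c , w) ≡ f (c , w) + f (c - 1ℤ , w - + i)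
  step-top i f c w = ≡-trans (step-def (top i) f (c , w)) (cong (λ u → f (c , w) + u) (ℤ.*-identityˡ _))

  step-bot : ∀ i f c w → step (bot i) f (c , w) ≡ f (c , w) + f (c + 1ℤ , w - + i)
  step-bot i f c w = ≡-trans (step-def (bot i) f (c , w)) (cong (λ u → f (c , w) + u) (ℤ.*-identityˡ _))

  step-eul : ∀ i f c w → step (eul i) f (c , w) ≡ f (c , w) - f (c , w - + i)
  step-eul i f c w = ≡-trans (step-def (eul i) f (c , w)) (cong (λ u → f (c , w) + u) (ℤ.-1*i≡-i _))

  tops bots euls : ℕ → List Atom
  tops zero    = []
  tops (suc n) = top (suc n) ∷ tops n
  bots zero    = []
  bots (suc n) = bot n ∷ bots n
  euls zero    = []
  euls (suc n) = eul (suc n) ∷ euls n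

  -- ∏_{i=1}^a (1 + z q^i) ∏_{i=0}^{b-1} (1 + z⁻¹ q^i)
  theta : ℕ → ℕ → Series
  theta a b = act (tops a ++ bots b) δ

  <-sub : ∀ {w B} i → w < B → w - + i < B
  <-sub i p = ℤ.≤-<-trans (ℤ.i-j≤i _ (+ i)) p

  sub-< : ∀ {w n} → w < + n → w - + n < 0ℤ
  sub-< {w} {n} p = subst (w - + n <_) (ℤ.+-inverseʳ (+ n)) (ℤ.+-monoˡ-< (- (+ n)) p)

  act-vanish : ∀ (P : Point → Set) (as : List Atom) f → (∀ a x → P x → P (drop a x)) →
               (∀ x → P x → f x ≡ 0ℤ) → ∀ x → P x → act as f x ≡ 0ℤ
  act-vanish P []       f cl z x p = z x p
  act-vanish P (a ∷ as) f cl z x p = ≡-trans (step-def a (act as f) x) (≡-trans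
    (cong₂ (λ u v → u + sgn a * v) (act-vanish P as f cl z x p) (act-vanish P as f cl z (drop a x) (cl a x p)))
    (≡-trans (ℤ.+-identityˡ (sgn a * 0ℤ)) (ℤ.*-zeroʳ (sgn a))))

  NegativeWeight : Point → Set
  NegativeWeight (c , w) = w < 0ℤ

  δ-negative : ∀ x → NegativeWeight x → δ x ≡ 0ℤ
  δ-negative (c , + w) (+<+ ())
  δ-negative (c , -[1+ w ]) p = ℤ.*-zeroʳ (δ₁ c)

  act-δ-negative : ∀ as x → NegativeWeight x → act as δ x ≡ 0ℤ
  act-δ-negative as = act-vanish NegativeWeight as δ (λ a _ p → <-sub (wt a) p) δ-negative

  theta-top : ∀ a b c w → w < + suc a → theta (suc a) b (c , w) ≡ theta a b (c , w)
  theta-top a b c w p = ≡-trans (step-top (suc a) (theta a b) c w) (≡-trans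
    (cong (λ u → theta a b (c , w) + u) (act-δ-negative (tops a ++ bots b) _ (sub-< p)))
    (ℤ.+-identityʳ _))

  theta-step-bot : ∀ a b x → theta a (suc b) x ≡ step (bot b) (theta a b) x
  theta-step-bot a b = act-↭ δ (shift (bot b) (tops a) (bots b))

  theta-bot : ∀ a b c w → w < + b → theta a (suc b) (c , w) ≡ theta a b (c , w)
  theta-bot a b c w p = ≡-trans (theta-step-bot a b (c , w)) (≡-trans (step-bot b (theta a b) c w) (≡-trans
    (cong (λ u → theta a b (c , w) + u) (act-δ-negative (tops a ++ bots b) _ (sub-< p)))
    (ℤ.+-identityʳ _)))

  at : ∀ (f : Series) {c c' w w'} → c ≡ c' → w ≡ w' → f (c , w) ≡ f (c' , w')
  at f refl refl = refl

  δ₁-cong : ∀ c u v → (c ≡ 0ℤ → u ≡ v) → δ₁ c * u ≡ δ₁ c * v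
  δ₁-cong (+ zero)  u v e = cong (1ℤ *_) (e refl)
  δ₁-cong (+ suc _) u v e = refl
  δ₁-cong -[1+ _ ]  u v e = refl

  raise₁ : ∀ c → c ≡ c - 1ℤ + 1ℤ
  raise₁ = solve-∀

  raise₂ : ∀ c w i → w - i - (1ℤ + c) ≡ w - c - (1ℤ + i)
  raise₂ = solve-∀

  raise₃ : ∀ c w i → w - i - (c + 1ℤ) ≡ w - c - (1ℤ + i)
  raise₃ = solve-∀

  raise₄ : ∀ c w i → w - (1ℤ + i) - (c - 1ℤ) ≡ w - c - i
  raise₄ = solve-∀

  -- Substituting z q for z exchanges the innermost factor 1 + z⁻¹ for z (1 + z⁻¹) = 1 + z.
  raise-base : ∀ b c w → theta 1 b (c , w) ≡ theta 0 (suc b) (c - 1ℤ , w - c)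
  raise-base zero c w = ≡-trans (step-top 1 δ c w) (≡-trans (ℤ.+-comm (δ (c , w)) _)
    (≡-trans (cong₂ _+_ first second) (sym (step-bot 0 δ (c - 1ℤ) (w - c)))))
    where
    first : δ (c - 1ℤ , w - 1ℤ) ≡ δ (c - 1ℤ , w - c)
    first = δ₁-cong (c - 1ℤ) _ _ λ e → cong (λ u → δ₁ (w - u)) (sym (ℤ.i-j≡0⇒i≡j c 1ℤ e))
    second : δ (c , w) ≡ δ (c - 1ℤ + 1ℤ , w - c - + 0)
    second = ≡-trans
      (δ₁-cong c _ _ λ e → cong δ₁ (sym (≡-trans (ℤ.+-identityʳ (w - c))
         (≡-trans (cong (λ u → w - u) e) (ℤ.+-identityʳ w)))))
      (at δ {w = w - c - + 0} (raise₁ c) refl)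
  raise-base (suc b) c w = ≡-trans (step-comm (top 1) (bot b) (act (bots b) δ) (c , w)) (≡-trans
    (step-bot b (theta 1 b) c w) (≡-trans
    (cong₂ _+_ (raise-base b c w) (≡-trans (raise-base b (c + 1ℤ) (w - + b))
      (at (theta 0 (suc b)) (pred-suc c) (raise₃ c w (+ b)))))
    (sym (step-bot (suc b) (theta 0 (suc b)) (c - 1ℤ) (w - c)))))

  -- The functional equation θ(a+1, b; z) = z q θ(a, b+1; z q), exact for finite products because
  -- the total number of factors stays the same. Passing from charge c to c - 1 costs weight c.
  raise : ∀ a b c w → theta (suc a) b (c , w) ≡ theta a (suc b) (c - 1ℤ , w - c)
  raise zero    b c w = raise-base b c w
  raise (suc a) b c w = ≡-trans (step-top (suc (suc a)) (theta (suc a) b) c w) (≡-trans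
    (cong₂ _+_ (raise a b c w) (≡-trans (raise a b (c - 1ℤ) (w - + suc (suc a)))
      (at (theta a (suc b)) {c - 1ℤ - 1ℤ} refl (raise₄ c w (+ suc a)))))
    (sym (step-top (suc a) (theta a (suc b)) (c - 1ℤ) (w - c))))

  -- The factors 1 - q^i leave the charge alone, so E acts on each charge slice separately and does
  -- not notice a common weight shift.
  euls-slice : ∀ n c c' t {f g : Series} B → (∀ w → w < B → f (c , w) ≡ g (c' , w - t)) →
               ∀ w → w < B → act (euls n) f (c , w) ≡ act (euls n) g (c' , w - t)
  euls-slice zero    c c' t B e w p = e w p
  euls-slice (suc n) c c' t {f} {g} B e w p = ≡-trans (step-eul (suc n) (act (euls n) f) c w) (≡-trans
    (cong₂ _-_ (euls-slice n c c' t {f} {g} B e w p)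
       (≡-trans (euls-slice n c c' t {f} {g} B e (w - + suc n) (<-sub (suc n) p))
         (at (act (euls n) g) {c'} refl (sub-comm w (+ suc n) t))))
    (sym (step-eul (suc n) (act (euls n) g) c' (w - t))))

  act-step : ∀ as a f x → act as (step a f) x ≡ step a (act as f) x
  act-step []       a f x = refl
  act-step (b ∷ as) a f x = ≡-trans (step-cong b (act-step as a f) x) (step-comm b a (act as f) x)

  bots-nonnegative : ∀ b n w → act (bots b) δ (+ n , w) ≡ δ (+ n , w)
  bots-nonnegative zero    n w = refl
  bots-nonnegative (suc b) n w = ≡-trans (step-bot b (act (bots b) δ) (+ n) w) (≡-trans
    (cong₂ _+_ (bots-nonnegative b n w) (≡-trans (bots-nonnegative b (n ℕ.+ 1) (w - + b))
      (at δ {w = w - + b} (cong +_ (ℕ.+-comm n 1)) refl)))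
    (ℤ.+-identityʳ _))

  add-sub : ∀ u v → u + v - v ≡ u
  add-sub = solve-∀

  -- In charge 0 the limit b → ∞ satisfies (1 - q^a) G_a = G_{a-1}.
  theta-zero-step : ∀ a b w → w < + b →
    step (eul (suc a)) (theta (suc a) b) (0ℤ , w) ≡ theta a b (0ℤ , w)
  theta-zero-step a b w p = ≡-trans (step-eul (suc a) (theta (suc a) b) 0ℤ w) (≡-trans
    (cong (_- theta (suc a) b (0ℤ , v)) (≡-trans (step-top (suc a) (theta a b) 0ℤ w)
      (cong (λ u → theta a b (0ℤ , w) + u) flip)))
    (add-sub (theta a b (0ℤ , w)) (theta (suc a) b (0ℤ , v))))
    where
    v = w - + suc a
    -- At charge 0 `raise` does not move the weight, so charge -1 is again a charge-0 coefficient,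
    -- with one more top factor.
    flip : theta a b (-1ℤ , v) ≡ theta (suc a) b (0ℤ , v)
    flip = ≡-trans (sym (theta-bot a b -1ℤ v (<-sub (suc a) p))) (≡-trans
      (at (theta a (suc b)) { -1ℤ} refl (sym (ℤ.+-identityʳ v))) (sym (raise a b 0ℤ v)))

  -- This fixes the constant of the triple product. Each Euler factor removes one top factor, until
  -- only factors 1 + z⁻¹ q^i are left, and their product has constant term 1.
  euls-theta-zero : ∀ a b w → w < + b → act (euls a) (theta a b) (0ℤ , w) ≡ δ (0ℤ , w)
  euls-theta-zero zero    b w p = bots-nonnegative b 0 w
  euls-theta-zero (suc a) b w p = ≡-trans (sym (act-step (euls a) (eul (suc a)) (theta (suc a) b) (0ℤ , w)))
    (≡-trans
      (euls-slice a 0ℤ 0ℤ 0ℤ {g = theta a b} (+ b)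
        (λ v q → ≡-trans (theta-zero-step a b v q) (at (theta a b) {0ℤ} refl (sym (ℤ.+-identityʳ v)))) w p)
      (≡-trans (at (act (euls a) (theta a b)) {0ℤ} refl (ℤ.+-identityʳ w)) (euls-theta-zero a b w p)))

  tri : ℕ → ℕ
  tri zero    = 0
  tri (suc n) = tri n ℕ.+ suc n

  -- T c = c (c + 1) / 2
  T : ℤ → ℤ
  T (+ n)    = + tri n
  T -[1+ n ] = + tri n

  sub-assoc : ∀ w m n → w - n - m ≡ w - (m + n)
  sub-assoc = solve-∀

  -- A top factor is added, traded by `raise` for a bottom factor, and that one is removed. Both
  -- have weight at least `N` and are invisible below it, so the same truncation returns at each
  -- step; the costs n, n - 1, ..., 1 add up to `tri n`.
  theta-shift⁺ : ∀ N n w → w < + N → theta N N (+ n , w) ≡ theta N N (0ℤ , w - + tri n)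
  theta-shift⁺ N zero    w p = at (theta N N) {0ℤ} refl (sym (ℤ.+-identityʳ w))
  theta-shift⁺ N (suc n) w p = ≡-trans
    (sym (theta-top N N (+ suc n) w (ℤ.<-trans p (+<+ (ℕ.n<1+n N))))) (≡-trans
    (raise N N (+ suc n) w) (≡-trans
    (theta-bot N N (+ n) (w - + suc n) (<-sub (suc n) p)) (≡-trans
    (theta-shift⁺ N n (w - + suc n) (<-sub (suc n) p))
    (at (theta N N) {0ℤ} refl (sub-assoc w (+ tri n) (+ suc n))))))

  neg-pred : ∀ n → -[1+ n ] ≡ - (+ n) - 1ℤ
  neg-pred zero    = refl
  neg-pred (suc n) = cong (λ k → -[1+ suc k ]) (sym (ℕ.+-identityʳ n))

  sub-neg-cancel : ∀ w n → w ≡ w - n - - n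
  sub-neg-cancel = solve-∀

  theta-lower : ∀ N n w → w < + N → theta N N (-[1+ n ] , w) ≡ theta N N (- (+ n) , w - + n)
  theta-lower N n w p = ≡-trans (sym (theta-bot N N -[1+ n ] w p)) (≡-trans
    (at (theta N (suc N)) (neg-pred n) (sub-neg-cancel w (+ n))) (≡-trans
    (sym (raise N N (- (+ n)) (w - + n)))
    (theta-top N N (- (+ n)) (w - + n) (<-sub n (ℤ.<-trans p (+<+ (ℕ.n<1+n N)))))))

  theta-shift⁻ : ∀ N n w → w < + N → theta N N (-[1+ n ] , w) ≡ theta N N (0ℤ , w - + tri n)
  theta-shift⁻ N zero    w p = theta-lower N zero w p
  theta-shift⁻ N (suc n) w p = ≡-trans (theta-lower N (suc n) w p) (≡-trans
    (theta-shift⁻ N n (w - + suc n) (<-sub (suc n) p))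
    (at (theta N N) {0ℤ} refl (sub-assoc w (+ tri n) (+ suc n))))

  theta-shift : ∀ N c w → w < + N → theta N N (c , w) ≡ theta N N (0ℤ , w - T c)
  theta-shift N (+ n)    = theta-shift⁺ N n
  theta-shift N -[1+ n ] = theta-shift⁻ N n

  -- Σ_c z^c q^{c(c+1)/2}
  Θ : Series
  Θ (c , w) = δ₁ (w - T c)

  <-sub-T : ∀ {w B} c → w < B → w - T c < B
  <-sub-T (+ n)    = <-sub (tri n)
  <-sub-T -[1+ n ] = <-sub (tri n)

  jacobi-triple : ∀ N c w → w < + N → act (euls N) (theta N N) (c , w) ≡ Θ (c , w)
  jacobi-triple N c w p = ≡-trans
    (euls-slice N c 0ℤ (T c) {g = theta N N} (+ N) (theta-shift N c) w p)
    (≡-trans (euls-theta-zero N N (w - T c) (<-sub-T c p)) (ℤ.*-identityˡ (δ₁ (w - T c))))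

  -- Jacobi's identity for (q)³

  ∑ : ℕ → (ℕ → ℤ) → ℤ
  ∑ zero    g = 0ℤ
  ∑ (suc n) g = ∑ n g + g n

  ∑-cong : ∀ n {g h} → (∀ k → g k ≡ h k) → ∑ n g ≡ ∑ n h
  ∑-cong zero    e = refl
  ∑-cong (suc n) e = cong₂ _+_ (∑-cong n e) (e n)

  linear-ring : ∀ s a b c d → a + s * b + (c + s * d) ≡ a + c + s * (b + d)
  linear-ring = solve-∀

  ∑-linear : ∀ n s g h → ∑ n (λ k → g k + s * h k) ≡ ∑ n g + s * ∑ n h
  ∑-linear zero    s g h = sym (≡-trans (ℤ.+-identityˡ (s * 0ℤ)) (ℤ.*-zeroʳ s))
  ∑-linear (suc n) s g h = ≡-trans (cong (_+ (g n + s * h n)) (∑-linear n s g h))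
    (linear-ring s (∑ n g) (∑ n h) (g n) (h n))

  ∑-∣ : ∀ {p} n g → (∀ k → p ∣ g k) → p ∣ ∑ n g
  ∑-∣ zero    g d = divides 0ℤ refl
  ∑-∣ (suc n) g d = ∣m∣n⇒∣m+n (∑-∣ n g d) (d n)

  ∑-zero : ∀ n g → (∀ k → k ℕ.< n → g k ≡ 0ℤ) → ∑ n g ≡ 0ℤ
  ∑-zero zero    g z = refl
  ∑-zero (suc n) g z = cong₂ _+_ (∑-zero n g λ k p → z k (ℕ.m<n⇒m<1+n p)) (z n (ℕ.n<1+n n))

  ∑-single : ∀ n m g → m ℕ.< n → (∀ k → k ≢ m → g k ≡ 0ℤ) → ∑ n g ≡ g m
  ∑-single (suc n) m g p z with n ℕ.≟ m
  ... | yes refl = ≡-trans (cong (_+ g n) (∑-zero n g λ k q → z k (ℕ.<⇒≢ q))) (ℤ.+-identityˡ (g n))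
  ... | no n≢m   = ≡-trans
    (cong₂ _+_ (∑-single n m g (ℕ.≤∧≢⇒< (ℕ.≤-pred p) (λ e → n≢m (sym e))) z) (z n n≢m))
    (ℤ.+-identityʳ (g m))

  ∑-shift-ring : ∀ a b c d → a + c ≡ b → a + d + c ≡ b + d
  ∑-shift-ring a b c d refl = ring a c d
    where
    ring : ∀ a c d → a + d + c ≡ a + c + d
    ring = solve-∀

  ∑-shift : ∀ n h → ∑ n (h ∘ suc) + h 0 ≡ ∑ n h + h n
  ∑-shift zero    h = refl
  ∑-shift (suc n) h =
    ∑-shift-ring (∑ n (h ∘ suc)) (∑ n h + h n) (h 0) (h (suc n)) (∑-shift n h)

  ∑-shift₀ : ∀ n h → h 0 ≡ 0ℤ → h n ≡ 0ℤ → ∑ n (h ∘ suc) ≡ ∑ n h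
  ∑-shift₀ n h e e' = ≡-trans (sym (ℤ.+-identityʳ _)) (≡-trans
    (cong (λ u → ∑ n (h ∘ suc) + u) (sym e)) (≡-trans (∑-shift n h)
    (≡-trans (cong (λ u → ∑ n h + u) e') (ℤ.+-identityʳ _))))

  -- Charges are summed over the window -K ≤ c ≤ K.
  charge : ℕ → ℕ → ℤ
  charge K k = + k - + K

  window : ℕ → ℕ
  window K = suc (K ℕ.+ K)

  charge-suc : ∀ K k → charge K (suc k) ≡ charge K k + 1ℤ
  charge-suc K k = ring (+ k) (+ K)
    where
    ring : ∀ k K → 1ℤ + k - K ≡ k - K + 1ℤ
    ring = solve-∀

  charge-last : ∀ K → charge K (window K) ≡ + suc K
  charge-last K = ring (+ K)
    where
    ring : ∀ K → 1ℤ + (K + K) - K ≡ 1ℤ + K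
    ring = solve-∀

  charge-first : ∀ K → charge K 0 ≡ - (+ K)
  charge-first K = ℤ.+-identityˡ (- (+ K))

  Supported : ℕ → Series → Set
  Supported m f = ∀ c w → m ℕ.< ℤ.∣ c ∣ → f (c , w) ≡ 0ℤ

  δ-supported : Supported 0 δ
  δ-supported (+ suc c) w p = refl
  δ-supported -[1+ c ]  w p = refl

  ch-abs : ∀ a c → ℤ.∣ c ∣ ℕ.≤ suc ℤ.∣ ch a c ∣
  ch-abs a c = subst (λ d → ℤ.∣ d ∣ ℕ.≤ suc ℤ.∣ ch a c ∣) (ring a)
    (ℕ.≤-trans (ℤ.∣i+j∣≤∣i∣+∣j∣ (ch a c) (κ a))
    (ℕ.≤-trans (ℕ.+-monoʳ-≤ ℤ.∣ ch a c ∣ (bound a)) (ℕ.≤-reflexive (ℕ.+-comm ℤ.∣ ch a c ∣ 1))))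
    where
    bound : ∀ a → ℤ.∣ κ a ∣ ℕ.≤ 1
    bound (top _) = ℕ.s≤s ℕ.z≤n
    bound (bot _) = ℕ.s≤s ℕ.z≤n
    bound (eul _) = ℕ.z≤n
    ring : ∀ a → ch a c + κ a ≡ c
    ring a = ≡-trans (cong (_+ κ a) (ch-κ a c)) (sub-add c (κ a))

  act-supported : ∀ as → Supported (length as) (act as δ)
  act-supported []       c w p = δ-supported c w p
  act-supported (a ∷ as) c w p = ≡-trans (step-def a (act as δ) (c , w)) (≡-trans
    (cong₂ (λ u v → u + sgn a * v) (act-supported as c w (ℕ.<-trans (ℕ.n<1+n _) p))
       (act-supported as (ch a c) (w - + wt a) (ℕ.≤-pred (ℕ.≤-trans p (ch-abs a c)))))
    (≡-trans (ℤ.+-identityˡ (sgn a * 0ℤ)) (ℤ.*-zeroʳ (sgn a))))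

  -- (-1)^c
  sg : ℤ → ℤ
  sg (+ zero)     = 1ℤ
  sg (+ suc n)    = - sg (+ n)
  sg -[1+ zero ]  = -1ℤ
  sg -[1+ suc n ] = - sg -[1+ n ]

  sg-pred : ∀ c → sg (c - 1ℤ) ≡ - sg c
  sg-pred (+ zero)  = refl
  sg-pred (+ suc n) = sym (ℤ.neg-involutive (sg (+ n)))
  sg-pred -[1+ n ]  = cong (λ k → - sg -[1+ k ]) (ℕ.+-identityʳ n)

  sg-suc : ∀ c → sg (c + 1ℤ) ≡ - sg c
  sg-suc c = ≡-trans (sym (ℤ.neg-involutive _)) (cong -_ (≡-trans (sym (sg-pred (c + 1ℤ))) (cong sg (add-sub c 1ℤ))))

  -- Σ_c u(c) [z^c] f; for u(c) = (-1)^c this is the substitution z = -1.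
  L : ℕ → (ℤ → ℤ) → Series → ℤ → ℤ
  L K u f w = ∑ (window K) λ k → u (charge K k) * f (charge K k , w)

  mul-linear-ring : ∀ u s a b → u * (a + s * b) ≡ u * a + s * (u * b)
  mul-linear-ring = solve-∀

  -- The shifted window gains c = K + 1 and loses c = -K; the hypotheses kill exactly these two
  -- terms.
  ∑-up : ∀ K h → h (- (+ K)) ≡ 0ℤ → h (+ suc K) ≡ 0ℤ →
         ∑ (window K) (λ k → h (charge K k + 1ℤ)) ≡ ∑ (window K) (λ k → h (charge K k))
  ∑-up K h e e' = ≡-trans (∑-cong (window K) λ k → cong h (sym (charge-suc K k)))
    (∑-shift₀ (window K) (h ∘ charge K) (≡-trans (cong h (charge-first K)) e)
       (≡-trans (cong h (charge-last K)) e'))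

  ∑-down : ∀ K h → h (- (+ K) - 1ℤ) ≡ 0ℤ → h (+ K) ≡ 0ℤ →
           ∑ (window K) (λ k → h (charge K k - 1ℤ)) ≡ ∑ (window K) (λ k → h (charge K k))
  ∑-down K h e e' = ≡-trans (sym (∑-up K (λ c → h (c - 1ℤ)) e e'))
    (∑-cong (window K) λ k → cong h (add-sub (charge K k) 1ℤ))

  abs-neg : ∀ m K → m ℕ.< K → m ℕ.< ℤ.∣ - (+ K) ∣
  abs-neg m K p = subst (m ℕ.<_) (sym (ℤ.∣-i∣≡∣i∣ (+ K))) p

  abs-neg-pred : ∀ m K → m ℕ.< K → m ℕ.< ℤ.∣ - (+ K) - 1ℤ ∣
  abs-neg-pred m K p = subst (λ i → m ℕ.< ℤ.∣ i ∣) (neg-pred K) (ℕ.m<n⇒m<1+n p)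

  zero-at : ∀ {m} (f : Series) → Supported m f → ∀ v c w → m ℕ.< ℤ.∣ c ∣ → v * f (c , w) ≡ 0ℤ
  zero-at f s v c w p = ≡-trans (cong (v *_) (s c w p)) (ℤ.*-zeroʳ v)

  eulered : Atom → Atom
  eulered a = eul (wt a)

  L-step : ∀ K u f a w → L K u (step a f) w ≡
           L K u f w + sgn a * ∑ (window K) (λ k → u (charge K k) * f (drop a (charge K k , w)))
  L-step K u f a w = ≡-trans
    (∑-cong (window K) λ k → ≡-trans (cong (u (charge K k) *_) (step-def a f (charge K k , w)))
       (mul-linear-ring (u (charge K k)) (sgn a) _ _))
    (∑-linear (window K) (sgn a) (λ k → u (charge K k) * f (charge K k , w)) _)

  neg-mul-ring : ∀ u v → u * v ≡ -1ℤ * (- u * v)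
  neg-mul-ring = solve-∀

  ∑-neg : ∀ n g → ∑ n (λ k → -1ℤ * g k) ≡ -1ℤ * ∑ n g
  ∑-neg n g = ≡-trans (∑-cong n λ k → sym (ℤ.+-identityˡ (-1ℤ * g k)))
    (≡-trans (∑-linear n -1ℤ (λ _ → 0ℤ) g) (≡-trans (cong (_+ -1ℤ * ∑ n g) (∑-zero n _ λ _ _ → refl)) (ℤ.+-identityˡ _)))

  -- At z = -1 both 1 + z q^i and 1 + z⁻¹ q^i become 1 - q^i. The bound m < K keeps the support
  -- strictly inside the window, so shifting the charge by one loses no term.
  L-sg-step : ∀ K {m} f → Supported m f → m ℕ.< K → ∀ a → Charged a → ∀ w →
              L K sg (step a f) w ≡ L K sg f w - L K sg f (w - + wt a)
  L-sg-step K {m} f s p (top i) _ w = ≡-trans (L-step K sg f (top i) w) (cong (λ u → L K sg f w + u)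
    (≡-trans (ℤ.*-identityˡ _) (≡-trans
    (∑-cong (window K) λ k → ≡-trans (neg-mul-ring (sg (charge K k)) _)
       (cong (λ u → -1ℤ * (u * f (charge K k - 1ℤ , w - + i))) (sym (sg-pred (charge K k)))))
    (≡-trans (∑-neg (window K) _)
    (≡-trans (ℤ.-1*i≡-i _) (cong -_
      (∑-down K (λ c → sg c * f (c , w - + i))
        (zero-at f s (sg (- (+ K) - 1ℤ)) _ (w - + i) (abs-neg-pred m K p))
        (zero-at f s (sg (+ K)) _ (w - + i) p))))))))
  L-sg-step K {m} f s p (bot i) _ w = ≡-trans (L-step K sg f (bot i) w) (cong (λ u → L K sg f w + u)
    (≡-trans (ℤ.*-identityˡ _) (≡-trans
    (∑-cong (window K) λ k → ≡-trans (neg-mul-ring (sg (charge K k)) _)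
       (cong (λ u → -1ℤ * (u * f (charge K k + 1ℤ , w - + i))) (sym (sg-suc (charge K k)))))
    (≡-trans (∑-neg (window K) _)
    (≡-trans (ℤ.-1*i≡-i _) (cong -_
      (∑-up K (λ c → sg c * f (c , w - + i))
        (zero-at f s (sg (- (+ K))) _ (w - + i) (abs-neg m K p))
        (zero-at f s (sg (+ suc K)) _ (w - + i) (ℕ.m<n⇒m<1+n p)))))))))
  L-sg-step K f s p (eul i) (inj₁ ()) w
  L-sg-step K f s p (eul i) (inj₂ ()) w

  δ₁-nonzero : ∀ {c} → c ≢ 0ℤ → δ₁ c ≡ 0ℤ
  δ₁-nonzero {+ zero}   n = ⊥-elim (n refl)
  δ₁-nonzero {+ suc _}  n = refl
  δ₁-nonzero { -[1+ _ ]} n = refl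

  -- The constant 1 among series in q alone. It is made independent of the charge so that `eul`
  -- atoms can act on it; the charge argument is then a dummy.
  δʷ : Series
  δʷ (c , w) = δ₁ w

  L-sg-δ : ∀ K w → L K sg δ w ≡ δ₁ w
  L-sg-δ K w = ≡-trans (∑-single (window K) K _ (ℕ.s≤s (ℕ.m≤m+n K K)) other) middle
    where
    other : ∀ k → k ≢ K → sg (charge K k) * δ (charge K k , w) ≡ 0ℤ
    other k n = ≡-trans
      (cong (λ u → sg (charge K k) * (u * δ₁ w))
        (δ₁-nonzero {charge K k} λ e → n (ℤ.+-injective (ℤ.i-j≡0⇒i≡j (+ k) (+ K) e))))
      (ℤ.*-zeroʳ (sg (charge K k)))
    middle : sg (charge K K) * δ (charge K K , w) ≡ δ₁ w
    middle rewrite ℤ.+-inverseʳ (+ K) = ≡-trans (ℤ.*-identityˡ _) (ℤ.*-identityˡ (δ₁ w))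

  L-sg-act : ∀ K as → All Charged as → length as ℕ.< K → ∀ c w →
             L K sg (act as δ) w ≡ act (map eulered as) δʷ (c , w)
  L-sg-act K []       []         p c w = L-sg-δ K w
  L-sg-act K (a ∷ as) (ca ∷ cas) p c w = ≡-trans
    (L-sg-step K (act as δ) (act-supported as) q a ca w) (≡-trans
    (cong₂ _-_ (L-sg-act K as cas q c w) (L-sg-act K as cas q c (w - + wt a)))
    (sym (step-eul (wt a) (act (map eulered as) δʷ) c w)))
    where
    q : length as ℕ.< K
    q = ℕ.<-trans (ℕ.n<1+n _) p

  bots⁺ : ℕ → List Atom
  bots⁺ zero    = []
  bots⁺ (suc n) = bot (suc n) ∷ bots⁺ n

  bots-↭ : ∀ n → bots (suc n) ↭ bot 0 ∷ bots⁺ n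
  bots-↭ zero    = refl
  bots-↭ (suc n) = trans (prep (bot (suc n)) (bots-↭ n)) (swap (bot (suc n)) (bot 0) refl)

  odd-weight : ℤ → ℤ
  odd-weight c = sg c * (+ 2 * c + 1ℤ)

  odd-weight-ring : ∀ s c g → s * (+ 2 * c + 1ℤ) * g + - s * (+ 2 * (c - 1ℤ) + 1ℤ) * g ≡ s * g + s * g
  odd-weight-ring = solve-∀

  odd-weight-pred : ∀ c g → odd-weight c * g + odd-weight (c - 1ℤ) * g ≡ sg c * g + sg c * g
  odd-weight-pred c g = ≡-trans
    (cong (λ s → odd-weight c * g + s * (+ 2 * (c - 1ℤ) + 1ℤ) * g) (sg-pred c))
    (odd-weight-ring (sg c) c g)

  ∑-+ : ∀ n g h → ∑ n (λ k → g k + h k) ≡ ∑ n g + ∑ n h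
  ∑-+ n g h = ≡-trans (∑-cong n λ k → cong (λ u → g k + u) (sym (ℤ.*-identityˡ (h k))))
    (≡-trans (∑-linear n 1ℤ g h) (cong (λ u → ∑ n g + u) (ℤ.*-identityˡ _)))

  -- At z = -1 the operator 2 z d/dz + 1 takes (1 + z⁻¹) f to 2 f(-1).
  L-odd-step : ∀ K {m} f → Supported m f → m ℕ.< K → ∀ w →
               L K odd-weight (step (bot 0) f) w ≡ L K sg f w + L K sg f w
  L-odd-step K {m} f s p w = ≡-trans (L-step K odd-weight f (bot 0) w) (≡-trans
    (cong (λ u → L K odd-weight f w + u) (≡-trans (ℤ.*-identityˡ _) (≡-trans
      (∑-cong (window K) λ k → cong₂ (λ c v → odd-weight c * f (charge K k + 1ℤ , v))
         (sym (add-sub (charge K k) 1ℤ)) (ℤ.+-identityʳ w))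
      (∑-up K (λ c → odd-weight (c - 1ℤ) * f (c , w))
        (zero-at f s (odd-weight (- (+ K) - 1ℤ)) _ w (abs-neg m K p))
        (zero-at f s (odd-weight (+ suc K - 1ℤ)) _ w (ℕ.m<n⇒m<1+n p))))))
    (≡-trans (sym (∑-+ (window K) _ _)) (≡-trans
    (∑-cong (window K) λ k → odd-weight-pred (charge K k) (f (charge K k , w)))
    (∑-+ (window K) _ _))))

  L-euls : ∀ K u n f c w → L K u (act (euls n) f) w ≡ act (euls n) (λ x → L K u f (proj₂ x)) (c , w)
  L-euls K u zero    f c w = refl
  L-euls K u (suc n) f c w = ≡-trans (L-step K u (act (euls n) f) (eul (suc n)) w) (≡-trans
    (cong₂ (λ a b → a + -1ℤ * b) (L-euls K u n f c w) (L-euls K u n f c (w - + suc n)))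
    (sym (step-def (eul (suc n)) _ (c , w))))

  tops-charged : ∀ n → All Charged (tops n)
  tops-charged zero    = []
  tops-charged (suc n) = inj₁ refl ∷ tops-charged n

  bots-charged : ∀ n → All Charged (bots n)
  bots-charged zero    = []
  bots-charged (suc n) = inj₂ refl ∷ bots-charged n

  bots⁺-charged : ∀ n → All Charged (bots⁺ n)
  bots⁺-charged zero    = []
  bots⁺-charged (suc n) = inj₂ refl ∷ bots⁺-charged n

  eulered-tops : ∀ n → map eulered (tops n) ≡ euls n
  eulered-tops zero    = refl
  eulered-tops (suc n) = cong (eul (suc n) ∷_) (eulered-tops n)

  eulered-bots⁺ : ∀ n → map eulered (bots⁺ n) ≡ euls n
  eulered-bots⁺ zero    = refl
  eulered-bots⁺ (suc n) = cong (eul (suc n) ∷_) (eulered-bots⁺ n)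

  cube : ℕ → Series → Series
  cube N f = act (euls N) (act (euls N) (act (euls N) f))

  δ₁-∣ : ∀ {p} v d → (d ≡ 0ℤ → p ∣ v) → p ∣ v * δ₁ d
  δ₁-∣ v (+ zero)  h = ∣m⇒∣m*n 1ℤ (h refl)
  δ₁-∣ v (+ suc _) h = ∣n⇒∣m*n v (divides 0ℤ refl)
  δ₁-∣ v -[1+ _ ]  h = ∣n⇒∣m*n v (divides 0ℤ refl)

  halve₅-ring : ∀ x → + 3 * (x + x) - + 5 * x ≡ x
  halve₅-ring = solve-∀

  halve₅ : ∀ x → + 5 ∣ x + x → + 5 ∣ x
  -- 3 inverts 2 modulo 5.
  halve₅ x d = subst (+ 5 ∣_) (halve₅-ring x)
    (∣m∣n⇒∣m-n (∣n⇒∣m*n (+ 3) d) (∣m⇒∣m*n x ∣-refl))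

  double-act : ∀ as f x → act as (λ y → f y + f y) x ≡ act as f x + act as f x
  double-act []       f x = refl
  double-act (a ∷ as) f x = ≡-trans (step-def a _ x) (≡-trans
    (cong₂ (λ u v → u + sgn a * v) (double-act as f x) (double-act as f (drop a x)))
    (≡-trans (ring (sgn a) (act as f x) (act as f (drop a x)))
      (sym (cong₂ _+_ (step-def a (act as f) x) (step-def a (act as f) x)))))
    where
    ring : ∀ s u v → u + u + s * (v + v) ≡ u + s * v + (u + s * v)
    ring = solve-∀

  -- Jacobi's (q)³ = Σ_{c≥0} (-1)^c (2c+1) q^{c(c+1)/2}, read modulo 5.
  jacobi-cube : ∀ N w c₀ → w < + N → (∀ c → w ≡ T c → + 5 ∣ + 2 * c + 1ℤ) → + 5 ∣ cube N δʷ (c₀ , w)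
  jacobi-cube N w c₀ p bad = halve₅ _ (subst (+ 5 ∣_) (sym evaluate) (∑-∣ (window K) _ term))
    where
    as : List Atom
    as = tops N ++ bots⁺ N
    K : ℕ
    -- The charges of the product are at most `length as` in size; one more puts them strictly
    -- inside the window.
    K = suc (length as)
    charged : All Charged as
    charged = ++⁺ (tops-charged N) (bots⁺-charged N)
    -- First evaluation. Taking `suc N` bottom factors leaves, once the operator has used up
    -- `bot 0`, as many bottom as top factors: at z = -1 they give E twice, and the operator
    -- contributes the 2.
    square : ∀ c v → L K odd-weight (theta N (suc N)) v ≡
             act (euls N) (act (euls N) δʷ) (c , v) + act (euls N) (act (euls N) δʷ) (c , v)
    square c v = ≡-trans
      (∑-cong (window K) λ k → cong (odd-weight (charge K k) *_)
        (act-↭ δ (↭-trans (++⁺ˡ (tops N) (bots-↭ N)) (shift (bot 0) (tops N) (bots⁺ N))) (charge K k , v)))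
      (≡-trans (L-odd-step K (act as δ) (act-supported as) (ℕ.n<1+n _) v) (cong₂ _+_ one one))
      where
      one : L K sg (act as δ) v ≡ act (euls N) (act (euls N) δʷ) (c , v)
      one = ≡-trans (L-sg-act K as charged (ℕ.n<1+n _) c v) (≡-trans
        (cong (λ bs → act bs δʷ (c , v)) (≡-trans (map-++ eulered (tops N) (bots⁺ N))
          (cong₂ _++_ (eulered-tops N) (eulered-bots⁺ N))))
        (act-++ (euls N) (euls N) δʷ (c , v)))
    -- Second evaluation, by the triple product; the additional bottom factor has weight `N` and is
    -- not seen at `w`.
    coefficient : ∀ c → act (euls N) (theta N (suc N)) (c , w) ≡ δ₁ (w - T c)
    coefficient c = ≡-trans
      (euls-slice N c c 0ℤ {g = theta N N} (+ N) (λ v q → ≡-trans (theta-bot N N c v q)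
        (at (theta N N) {c} refl (sym (ℤ.+-identityʳ v)))) w p)
      (≡-trans (at (act (euls N) (theta N N)) {c} refl (ℤ.+-identityʳ w)) (jacobi-triple N c w p))
    evaluate : cube N δʷ (c₀ , w) + cube N δʷ (c₀ , w) ≡
               ∑ (window K) (λ k → odd-weight (charge K k) * δ₁ (w - T (charge K k)))
    evaluate = ≡-trans (sym (double-act (euls N) _ (c₀ , w))) (≡-trans
      (sym (act-cong (euls N) (λ x → square (proj₁ x) (proj₂ x)) (c₀ , w))) (≡-trans
      (sym (L-euls K odd-weight N (theta N (suc N)) c₀ w))
      (∑-cong (window K) λ k → cong (odd-weight (charge K k) *_) (coefficient (charge K k)))))
    term : ∀ k → + 5 ∣ odd-weight (charge K k) * δ₁ (w - T (charge K k))
    term k = δ₁-∣ (odd-weight (charge K k)) (w - T (charge K k)) λ e →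
      ∣n⇒∣m*n (sg (charge K k)) (bad (charge K k) (ℤ.i-j≡0⇒i≡j w (T (charge K k)) e))

  -- The two-coloured case modulo 5

  -- Composition with it is multiplication by z^k q^(T k), the k-th term of `Θ`.
  translate : ℤ → Point → Point
  translate k (c , w) = c - k , w - T k

  translate-drop : ∀ k a x → translate k (drop a x) ≡ drop a (translate k x)
  translate-drop k a (c , w) = cong₂ _,_ (commute a) (sub-comm w (+ wt a) (T k))
    where
    swap-add : ∀ c k → c + 1ℤ - k ≡ c - k + 1ℤ
    swap-add = solve-∀
    commute : ∀ a → ch a c - k ≡ ch a (c - k)
    commute (top _) = sub-comm c 1ℤ k
    commute (bot _) = swap-add c k
    commute (eul _) = refl

  everywhere : ∀ {R} → (∀ a {x y} → R x y → R (drop a x) (drop a y)) → ∀ as → All (Closed R) as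
  everywhere c []       = []
  everywhere c (a ∷ as) = c a ∷ everywhere c as

  act-translate : ∀ as f k x → act as (f ∘ translate k) x ≡ act as f (translate k x)
  act-translate as f k x = act-transfer (λ x y → translate k x ≡ y)
    (everywhere (λ a {x} e → ≡-trans (translate-drop k a x) (cong (drop a) e)) as)
    (λ e → cong f e) refl

  act-∑ : ∀ as n (F : ℕ → Series) x → act as (λ y → ∑ n (λ k → F k y)) x ≡ ∑ n (λ k → act as (F k) x)
  act-∑ []       n F x = refl
  act-∑ (a ∷ as) n F x = ≡-trans (step-def a _ x) (≡-trans
    (cong₂ (λ u v → u + sgn a * v) (act-∑ as n F x) (act-∑ as n F (drop a x))) (≡-trans
    (sym (∑-linear n (sgn a) (λ k → act as (F k) x) (λ k → act as (F k) (drop a x))))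
    (∑-cong n λ k → sym (step-def a (act as (F k)) x))))

  n≤tri : ∀ n → n ℕ.≤ tri n
  n≤tri zero    = ℕ.z≤n
  n≤tri (suc n) = ℕ.m≤n+m (suc n) (tri n)

  -- Since n ≤ `tri n`, T c < N forces -N ≤ c < N: the window of size `N` contains every term of `Θ`
  -- below weight `N`.
  find-charge : ∀ N c → T c < + N → Σ ℕ λ k → k ℕ.< window N × charge N k ≡ c
  find-charge N (+ n) (+<+ p) =
    n ℕ.+ N , ℕ.s≤s (ℕ.+-monoˡ-≤ N (ℕ.≤-trans (n≤tri n) (ℕ.<⇒≤ p))) , add-sub (+ n) (+ N)
  find-charge N -[1+ n ] (+<+ p) =
    N ℕ.∸ suc n , ℕ.s≤s (ℕ.≤-trans (ℕ.m∸n≤m N (suc n)) (ℕ.m≤m+n N N)) , (begin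
      + (N ℕ.∸ suc n) - + N  ≡⟨ cong (_- + N) (sym (ℤ.⊖-≥ n<N)) ⟩
      (N ℤ.⊖ suc n) - + N    ≡⟨ cong (_- + N) (sym (ℤ.m-n≡m⊖n N (suc n))) ⟩
      + N - + suc n - + N    ≡⟨ ring (+ N) (+ suc n) ⟩
      -[1+ n ]               ∎)
    where
    open ≡-Reasoning
    n<N : suc n ℕ.≤ N
    n<N = ℕ.≤-<-trans (n≤tri n) p
    ring : ∀ N n → N - n - N ≡ - n
    ring = solve-∀

  Θ-expansion : ∀ N c w → w < + N →
                Θ (c , w) ≡ ∑ (window N) (λ k → δ (translate (charge N k) (c , w)))
  Θ-expansion N c w p with w - T c ℤ.≟ 0ℤ
  ... | no w≢ = ≡-trans (δ₁-nonzero w≢) (sym (∑-zero (window N) _ λ k _ → off (charge N k)))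
    where
    off : ∀ d → δ₁ (c - d) * δ₁ (w - T d) ≡ 0ℤ
    off d = ≡-trans (δ₁-cong (c - d) _ 0ℤ λ e → δ₁-nonzero λ e' →
              w≢ (subst (λ b → w - T b ≡ 0ℤ) (sym (ℤ.i-j≡0⇒i≡j c d e)) e'))
            (ℤ.*-zeroʳ (δ₁ (c - d)))
  ... | yes w≡ with find-charge N c (subst (_< + N) (ℤ.i-j≡0⇒i≡j w (T c) w≡) p)
  ... | m , m< , refl = sym (≡-trans (∑-single (window N) m _ m< off) middle)
    where
    off : ∀ k → k ≢ m → δ (translate (charge N k) (charge N m , w)) ≡ 0ℤ
    off k k≢m = cong (_* δ₁ (w - T (charge N k))) (δ₁-nonzero λ e → k≢m (sym (ℤ.+-injective
      (ring (+ m) (+ k) (+ N) (ℤ.i-j≡0⇒i≡j (charge N m) (charge N k) e)))))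
      where
      cancel : ∀ m N → m - N + N ≡ m
      cancel = solve-∀
      ring : ∀ m k N → m - N ≡ k - N → m ≡ k
      ring m k N e = ≡-trans (sym (cancel m N)) (≡-trans (cong (_+ N) e) (cancel k N))
    middle : δ (translate (charge N m) (charge N m , w)) ≡ δ₁ (w - T (charge N m))
    middle = ≡-trans (cong (λ u → δ₁ u * δ₁ (w - T (charge N m))) (ℤ.+-inverseʳ (charge N m)))
                     (ℤ.*-identityˡ (δ₁ (w - T (charge N m))))

  act-comm : ∀ as bs f x → act as (act bs f) x ≡ act bs (act as f) x
  act-comm as bs f x = ≡-trans (sym (act-++ as bs f x))
    (≡-trans (act-↭ f (++-comm as bs) x) (act-++ bs as f x))

  power-suc : ∀ k as → power (suc k) as ↭ as ++ power k as
  power-suc k []       = refl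
  power-suc k (a ∷ as) = prep a (↭-trans (++⁺ˡ (replicate k a) (power-suc k as)) (shifts (replicate k a) as))

  act-power-suc : ∀ k as f x → act (power (suc k) as) f x ≡ act as (act (power k as) f) x
  act-power-suc k as f x = ≡-trans (act-↭ f (power-suc k as) x) (act-++ as (power k as) f x)

  act-power-one : ∀ as f x → act (power 1 as) f x ≡ act as f x
  act-power-one []       f x = refl
  act-power-one (a ∷ as) f x = step-cong a (act-power-one as f) x

  twoT⁺ : ∀ n → + tri n + + tri n ≡ + n * (+ n + 1ℤ)
  twoT⁺ zero    = refl
  twoT⁺ (suc n) = begin
    + tri n + + suc n + (+ tri n + + suc n)  ≡⟨ ring₁ (+ tri n) (+ n) ⟩
    + tri n + + tri n + (+ suc n + + suc n)  ≡⟨ cong (_+ (+ suc n + + suc n)) (twoT⁺ n) ⟩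
    + n * (+ n + 1ℤ) + (+ suc n + + suc n)   ≡⟨ ring₂ (+ n) ⟩
    + suc n * (+ suc n + 1ℤ)                 ∎
    where
    open ≡-Reasoning
    ring₁ : ∀ t n → t + (1ℤ + n) + (t + (1ℤ + n)) ≡ t + t + (1ℤ + n + (1ℤ + n))
    ring₁ = solve-∀
    ring₂ : ∀ n → n * (n + 1ℤ) + (1ℤ + n + (1ℤ + n)) ≡ (1ℤ + n) * (1ℤ + n + 1ℤ)
    ring₂ = solve-∀

  twoT : ∀ c → T c + T c ≡ c * (c + 1ℤ)
  twoT (+ n)    = twoT⁺ n
  twoT -[1+ n ] = ≡-trans (twoT⁺ n) (ring (+ n))
    where
    ring : ∀ n → n * (n + 1ℤ) ≡ - (1ℤ + n) * (- (1ℤ + n) + 1ℤ)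
    ring = solve-∀

  -- -8 is not a square modulo 5.
  residue-check : ∀ (r s : Fin 5) → 5 ℕ.∣ toℕ r ℕ.* toℕ r ℕ.+ 8 ℕ.* (toℕ s ℕ.* toℕ s) → toℕ r ≡ 0
  residue-check = from-yes (Fin.all? {5} λ r → Fin.all? {5} λ s →
    (5 ℕ.∣? (toℕ r ℕ.* toℕ r ℕ.+ 8 ℕ.* (toℕ s ℕ.* toℕ s))) →-dec (toℕ r ℕ.≟ 0))

  residue : ∀ x → Σ (Fin 5) λ r → Σ ℤ λ q → x ≡ + toℕ r + q * + 5
  residue x = fromℕ< (n%ℕd<d x 5) , x /ℕ 5 , ≡-trans (a≡a%ℕn+[a/ℕn]*n x 5)
    (cong (λ r → + r + (x /ℕ 5) * + 5) (sym (Fin.toℕ-fromℕ< (n%ℕd<d x 5))))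

  quadratic-form : ∀ x y → + 5 ∣ x * x + + 8 * (y * y) → + 5 ∣ x
  quadratic-form x y d with residue x | residue y
  ... | r , a , refl | s , b , refl =
    subst (λ t → + 5 ∣ + t + a * + 5) (sym (residue-check r s (∣⇒∣ᵤ small)))
      (divides a (ℤ.+-identityˡ (a * + 5)))
    where
    expand : ∀ r s a b → (r + a * + 5) * (r + a * + 5) + + 8 * ((s + b * + 5) * (s + b * + 5))
      - + 5 * (+ 2 * r * a + + 5 * a * a + + 16 * s * b + + 40 * b * b) ≡ r * r + + 8 * (s * s)
    expand = solve-∀
    cast : + toℕ r * + toℕ r + + 8 * (+ toℕ s * + toℕ s) ≡
           + (toℕ r ℕ.* toℕ r ℕ.+ 8 ℕ.* (toℕ s ℕ.* toℕ s))
    cast = sym (cong₂ _+_ (ℤ.pos-* (toℕ r) (toℕ r))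
      (≡-trans (ℤ.pos-* 8 (toℕ s ℕ.* toℕ s)) (cong (+ 8 *_) (ℤ.pos-* (toℕ s) (toℕ s)))))
    small : + 5 ∣ + (toℕ r ℕ.* toℕ r ℕ.+ 8 ℕ.* (toℕ s ℕ.* toℕ s))
    small = subst (+ 5 ∣_) (≡-trans (expand (+ toℕ r) (+ toℕ s) a b) cast)
      (∣m∣n⇒∣m-n d (∣m⇒∣m*n _ ∣-refl))

  -- T k + T (-k) = k², so eight times the equation plus one reads (2c + 1)² + 8k² = 8(5n + 3) + 1 =
  -- 5(8n + 5).
  exponent-class : ∀ n k c → + 5 * n + + 3 - T k - T (0ℤ - k) ≡ T c → + 5 ∣ + 2 * c + 1ℤ
  exponent-class n k c e = quadratic-form (+ 2 * c + 1ℤ) k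
    (divides (+ 8 * n + + 5) (begin
      (+ 2 * c + 1ℤ) * (+ 2 * c + 1ℤ) + + 8 * (k * k)
        ≡⟨ ring₁ c k ⟩
      + 4 * (c * (c + 1ℤ)) + + 4 * (k * (k + 1ℤ)) + + 4 * ((0ℤ - k) * (0ℤ - k + 1ℤ)) + 1ℤ
        ≡⟨ cong₂ (λ u v → + 4 * u + + 4 * v + + 4 * ((0ℤ - k) * (0ℤ - k + 1ℤ)) + 1ℤ) (sym (twoT c)) (sym (twoT k)) ⟩
      + 4 * (T c + T c) + + 4 * (T k + T k) + + 4 * ((0ℤ - k) * (0ℤ - k + 1ℤ)) + 1ℤ
        ≡⟨ cong₂ (λ u v → + 4 * (u + u) + + 4 * (T k + T k) + + 4 * v + 1ℤ) (sym e) (sym (twoT (0ℤ - k))) ⟩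
      + 4 * (+ 5 * n + + 3 - T k - T (0ℤ - k) + (+ 5 * n + + 3 - T k - T (0ℤ - k))) + + 4 * (T k + T k)
        + + 4 * (T (0ℤ - k) + T (0ℤ - k)) + 1ℤ
        ≡⟨ ring₂ n (T k) (T (0ℤ - k)) ⟩
      (+ 8 * n + + 5) * + 5 ∎))
    where
    open ≡-Reasoning
    ring₁ : ∀ c k → (+ 2 * c + 1ℤ) * (+ 2 * c + 1ℤ) + + 8 * (k * k) ≡
      + 4 * (c * (c + 1ℤ)) + + 4 * (k * (k + 1ℤ)) + + 4 * ((0ℤ - k) * (0ℤ - k + 1ℤ)) + 1ℤ
    ring₁ = solve-∀
    ring₂ : ∀ n s t → + 4 * (+ 5 * n + + 3 - s - t + (+ 5 * n + + 3 - s - t)) + + 4 * (s + s)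
        + + 4 * (t + t) + 1ℤ ≡ (+ 8 * n + + 5) * + 5
    ring₂ = solve-∀

  cube-slice : ∀ N c c' t {f g : Series} B → (∀ w → w < B → f (c , w) ≡ g (c' , w - t)) →
               ∀ w → w < B → cube N f (c , w) ≡ cube N g (c' , w - t)
  cube-slice N c c' t {f} {g} B e =
    euls-slice N c c' t {act (euls N) (act (euls N) f)} {act (euls N) (act (euls N) g)} B
      (euls-slice N c c' t {act (euls N) f} {act (euls N) g} B (euls-slice N c c' t {f} {g} B e))

  module _ (N : ℕ) where

    factors : List Atom
    factors = tops N ++ bots N

    normalized : Series
    normalized = act (euls N) (theta N N)

    -- E⁴F, the cofactor of one normalized EF in E⁵F².
    multiplier : List Atom
    multiplier = euls N ++ (euls N ++ (euls N ++ (euls N ++ factors)))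

    act-multiplier : ∀ f x → act multiplier f x ≡ cube N (act (euls N) (act factors f)) x
    act-multiplier f x = ≡-trans (act-++ (euls N) _ f x) (act-cong (euls N) (λ x →
      ≡-trans (act-++ (euls N) _ f x) (act-cong (euls N) (λ x →
        ≡-trans (act-++ (euls N) _ f x) (act-cong (euls N) (act-++ (euls N) factors f) x)) x)) x)

    -- E⁵F² rewritten as (E³·EF)(EF).
    regroup : ∀ x → act (power 5 (euls N)) (act (power 2 factors) δ) x ≡ act multiplier normalized x
    regroup x = ≡-trans (peel 4 f x) (≡-trans
      (e-cong (λ x → ≡-trans (peel 3 f x) (e-cong (λ x → ≡-trans (peel 2 f x) (e-cong (λ x →
        ≡-trans (peel 1 f x) (e-cong (λ x → ≡-trans (act-power-one (euls N) f x) inner) x)) x)) x)) x)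
      (sym (act-multiplier normalized x)))
      where
      f : Series
      f = act (power 2 factors) δ
      peel : ∀ k f x → act (power (suc k) (euls N)) f x ≡ act (euls N) (act (power k (euls N)) f) x
      peel k = act-power-suc k (euls N)
      e-cong : ∀ {f g} → (∀ x → f x ≡ g x) → ∀ x → act (euls N) f x ≡ act (euls N) g x
      e-cong = act-cong (euls N)
      inner : ∀ {x} → act (euls N) f x ≡ act factors normalized x
      inner {x} = ≡-trans (e-cong (λ x → ≡-trans (act-power-suc 1 factors δ x)
        (act-cong factors (act-power-one factors δ) x)) x) (act-comm (euls N) factors (theta N N) x)

    -- One EF is expanded into its theta terms, indexed by k. Total charge 0 leaves charge -k to the
    -- other EF, whose slice there is the single power q^(T (-k)). What remains is a coefficient of
    -- E³ at weight 5n + 3 - k², where `exponent-class` and `jacobi-cube` apply.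
    multiplier-∣ : ∀ n w → w ≡ + 5 * n + + 3 → w < + N → + 5 ∣ act multiplier normalized (0ℤ , w)
    multiplier-∣ n w refl p = subst (+ 5 ∣_) (sym expand) (∑-∣ (window N) _ term)
      where
      R : Point → Point → Set
      R x y = x ≡ y × proj₂ x < + N
      summand : ℕ → Series
      summand k = δ ∘ translate (charge N k)
      expand : act multiplier normalized (0ℤ , w) ≡
               ∑ (window N) (λ k → act multiplier δ (translate (charge N k) (0ℤ , w)))
      expand = ≡-trans
        (act-transfer R {multiplier} {normalized} {λ x → ∑ (window N) (λ k → summand k x)}
          (everywhere {R} (λ { a (refl , q) → refl , <-sub (wt a) q }) multiplier)
          (λ { {c , v} (refl , q) → ≡-trans (jacobi-triple N c v q) (Θ-expansion N c v q) }) (refl , p))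
        (≡-trans (act-∑ multiplier (window N) summand (0ℤ , w))
          (∑-cong (window N) λ k → act-translate multiplier δ (charge N k) (0ℤ , w)))
      term : ∀ k → + 5 ∣ act multiplier δ (translate (charge N k) (0ℤ , w))
      term k = subst (+ 5 ∣_) (sym (≡-trans (act-multiplier δ (translate d (0ℤ , w)))
          (cube-slice N (0ℤ - d) 0ℤ (T (0ℤ - d)) {normalized} {δʷ} (+ N) (jacobi-triple N (0ℤ - d)) (w - T d) q)))
        (jacobi-cube N (w - T d - T (0ℤ - d)) 0ℤ (<-sub-T (0ℤ - d) q) (exponent-class n d))
        where
        d : ℤ
        d = charge N k
        q : w - T d < + N
        q = <-sub-T d p

  -- Cancelling Euler factors modulo 5

  <-sub-suc : ∀ {w m} i → w < + suc m → w - + suc i < + m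
  <-sub-suc {w} i p = ℤ.≤-<-trans (subst (_≤ w - 1ℤ) (ring w (+ i)) (ℤ.i-j≤i (w - 1ℤ) (+ i))) (ℤ.+-monoˡ-< -1ℤ p)
    where
    ring : ∀ w i → w - 1ℤ - i ≡ w - (1ℤ + i)
    ring = solve-∀

  -- As (1 - q^j)⁵ ≡ 1 - q^(5j) with j = i + 1 ≥ 1, the coefficient at w is congruent to the one at
  -- w - 5j plus a multiple of 5. Descent reaches negative weights, where f is zero; closure of `Q`
  -- keeps the descent inside the region where the product is known.
  euler-cancel : ∀ i Q f → (∀ x → Q x → Q (dropⁿ 5 (eul (suc i)) x)) →
    (∀ x → NegativeWeight x → f x ≡ 0ℤ) →
    Vanish 5 Q (stepⁿ 5 (eul (suc i)) f) → Vanish 5 Q f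
  euler-cancel i Q f closed neg van (c , w) = descend ℤ.∣ w ∣ c w (bound w)
    where
    bound : ∀ w → w ≤ + ℤ.∣ w ∣
    bound (+ n)    = ℤ.≤-refl
    bound -[1+ n ] = ℤ.-≤+
    low : ∀ {m} w → w < + suc m → proj₂ (dropⁿ 5 (eul (suc i)) (0ℤ , w)) < + m
    low w p = <-sub (suc i) (<-sub (suc i) (<-sub (suc i) (<-sub (suc i) (<-sub-suc i p))))
    descend′ : ∀ m c w → w < + m → Q (c , w) → + 5 ∣ f (c , w)
    descend′ zero    c w p q = subst (+ 5 ∣_) (sym (neg (c , w) p)) (divides 0ℤ refl)
    descend′ (suc m) c w p q = ∣m+n∣n⇒∣m
      (∣-diff (f (c , w) + -1ℤ * f y) (stepⁿ 5 (eul (suc i)) f (c , w)) flip (van (c , w) q))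
      (∣n⇒∣m*n -1ℤ (descend′ m c (proj₂ y) (low w p) (closed (c , w) q)))
      where
      y : Point
      y = dropⁿ 5 (eul (suc i)) (c , w)
      neg-sub : ∀ a b → - (a - b) ≡ b - a
      neg-sub = solve-∀
      flip : + 5 ∣ f (c , w) + -1ℤ * f y - stepⁿ 5 (eul (suc i)) f (c , w)
      flip = subst (+ 5 ∣_) (neg-sub _ (f (c , w) + -1ℤ * f y))
        (∣m⇒∣-m (frobenius₅ (eul (suc i)) f (c , w)))
    descend : ∀ m c w → w ≤ + m → Q (c , w) → + 5 ∣ f (c , w)
    descend m c w p = descend′ (suc m) c w (ℤ.≤-<-trans p (+<+ (ℕ.n<1+n m)))

  euls-cancel : ∀ n Q bs → (∀ i x → Q x → Q (dropⁿ 5 (eul (suc i)) x)) →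
    Vanish 5 Q (act (power 5 (euls n)) (act bs δ)) → Vanish 5 Q (act bs δ)
  euls-cancel zero    Q bs closed van = van
  euls-cancel (suc n) Q bs closed van = euls-cancel n Q bs closed
    (euler-cancel n Q (act (power 5 (euls n)) (act bs δ)) (closed n)
      (λ x p → ≡-trans (sym (act-++ (power 5 (euls n)) bs δ x))
                 (act-δ-negative (power 5 (euls n) ++ bs) x p)) van)

  -- `n` is an integer, not a natural number, because the descent passes below weight 0.
  Class₃ : ℕ → Point → Set
  Class₃ N (c , w) = c ≡ 0ℤ × w < + N × Σ ℤ λ n → w ≡ + 5 * n + + 3

  class₃-closed : ∀ N i x → Class₃ N x → Class₃ N (dropⁿ 5 (eul (suc i)) x)
  class₃-closed N i (c , w) (refl , p , n , refl) = refl
    , <-sub (suc i) (<-sub (suc i) (<-sub (suc i) (<-sub (suc i) (<-sub (suc i) p))))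
    , n - + suc i , ring n (+ suc i)
    where
    ring : ∀ n i → + 5 * n + + 3 - i - i - i - i - i ≡ + 5 * (n - i) + + 3
    ring = solve-∀

  two-coloured : ∀ N → Vanish 5 (Class₃ N) (act (power 2 (tops N ++ bots N)) δ)
  two-coloured N = euls-cancel N (Class₃ N) (power 2 (tops N ++ bots N)) (class₃-closed N) vanish
    where
    vanish : Vanish 5 (Class₃ N) (act (power 5 (euls N)) (act (power 2 (tops N ++ bots N)) δ))
    vanish (c , w) (refl , p , n , e) =
      subst (+ 5 ∣_) (sym (regroup N (0ℤ , w))) (multiplier-∣ N n w e p)

  -- Counting Frobenius symbols

  -- Sets of factors, one from each binomial, whose product is z^c q^w.
  Selection : List Atom → Point → Set
  Selection []       (c , w) = c ≡ 0ℤ × w ≡ 0ℤ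
  Selection (a ∷ as) x       = Selection as x ⊎ Selection as (drop a x)

  count : List Atom → Point → ℕ
  count [] (+ zero , + zero) = 1
  count [] _                 = 0
  count (a ∷ as) x           = count as x ℕ.+ count as (drop a x)

  Fin0↔ : ∀ {A : Set} → ¬ A → Fin 0 ↔ A
  Fin0↔ n = mk↔ₛ′ (λ ()) (λ a → ⊥-elim (n a)) (λ a → ⊥-elim (n a)) (λ ())

  Fin1↔ : ∀ {A : Set} (a : A) → (∀ b → a ≡ b) → Fin 1 ↔ A
  Fin1↔ a u = mk↔ₛ′ (λ _ → a) (λ _ → Fin.zero) u (λ { Fin.zero → refl ; (Fin.suc ()) })

  count-↔ : ∀ as x → Fin (count as x) ↔ Selection as x
  count-↔ [] (+ zero , + zero)   = Fin1↔ (refl , refl) λ { (refl , refl) → refl }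
  count-↔ [] (+ zero , + suc _)  = Fin0↔ λ ()
  count-↔ [] (+ zero , -[1+ _ ]) = Fin0↔ λ ()
  count-↔ [] (+ suc _ , _)       = Fin0↔ λ ()
  count-↔ [] (-[1+ _ ] , _)      = Fin0↔ λ ()
  count-↔ (a ∷ as) x = (count-↔ as x ⊎-↔ count-↔ as (drop a x)) ↔-∘ Fin.+↔⊎

  charged-sgn : ∀ a → Charged a → sgn a ≡ 1ℤ
  charged-sgn (top _) _ = refl
  charged-sgn (bot _) _ = refl
  charged-sgn (eul _) (inj₁ ())
  charged-sgn (eul _) (inj₂ ())

  count-act : ∀ as → All Charged as → ∀ x → + count as x ≡ act as δ x
  count-act [] _ (+ zero , + zero)   = refl
  count-act [] _ (+ zero , + suc _)  = refl
  count-act [] _ (+ zero , -[1+ _ ]) = refl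
  count-act [] _ (+ suc _ , _)       = refl
  count-act [] _ (-[1+ _ ] , _)      = refl
  count-act (a ∷ as) (ca ∷ cas) x = ≡-trans
    (cong₂ _+_ (count-act as cas x)
      (≡-trans (count-act as cas (drop a x))
        (≡-trans (sym (ℤ.*-identityˡ _)) (cong (_* act as δ (drop a x)) (sym (charged-sgn a ca))))))
    (sym (step-def a (act as δ) x))

  -- Frobenius symbols as pairs of sublists

  module _ {k : ℕ} where

    _≻_ : Colored k → Colored k → Set
    x ≻ y = y ≺ x

    ≻-trans : ∀ {x y z} → x ≻ y → y ≻ z → x ≻ z
    ≻-trans (inj₁ p)          (inj₁ q)          = inj₁ (ℕ.<-trans q p)
    ≻-trans (inj₁ p)          (inj₂ (refl , _)) = inj₁ p
    ≻-trans (inj₂ (refl , _)) (inj₁ q)          = inj₁ q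
    ≻-trans (inj₂ (refl , p)) (inj₂ (refl , q)) = inj₂ (refl , ℕ.<-trans q p)

    ≻-irrefl : ∀ {x} → ¬ (x ≻ x)
    ≻-irrefl (inj₁ p)       = ℕ.<-irrefl refl p
    ≻-irrefl (inj₂ (_ , p)) = ℕ.<-irrefl refl p

    ≻-irrelevant : Irrelevant _≻_
    ≻-irrelevant (inj₁ p)       (inj₁ q)       = cong inj₁ (ℕ.<-irrelevant p q)
    ≻-irrelevant (inj₁ p)       (inj₂ (e , _)) = ⊥-elim (ℕ.<-irrefl e p)
    ≻-irrelevant (inj₂ (e , _)) (inj₁ q)       = ⊥-elim (ℕ.<-irrefl e q)
    ≻-irrelevant (inj₂ (e , p)) (inj₂ (f , q)) =
      cong inj₂ (cong₂ _,_ (ℕ.≡-irrelevant e f) (ℕ.<-irrelevant p q))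

    Decreasing : List (Colored k) → Set
    Decreasing = AllPairs _≻_

    ⊆-All : ∀ {P : Colored k → Set} {xs ys} → xs ⊆ ys → All P ys → All P xs
    ⊆-All []         []       = []
    ⊆-All (y ∷ʳ p)   (_ ∷ qs) = ⊆-All p qs
    ⊆-All (refl ∷ p) (q ∷ qs) = q ∷ ⊆-All p qs

    ⊆-decreasing : ∀ {xs ys} → xs ⊆ ys → Decreasing ys → Decreasing xs
    ⊆-decreasing []         []       = []
    ⊆-decreasing (y ∷ʳ p)   (_ ∷ ds) = ⊆-decreasing p ds
    ⊆-decreasing (refl ∷ p) (d ∷ ds) = ⊆-All p d ∷ ⊆-decreasing p ds

    below-tail : ∀ {y z ys} → y ≻ z → z ∈ y ∷ ys → z ∈ ys
    below-tail y≻z (here refl) = ⊥-elim (≻-irrefl y≻z)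
    below-tail y≻z (there z∈)  = z∈

    -- Whether x is the head y of `ys` or occurs later, all entries after x are below y, so they
    -- must be found in the tail.
    decreasing-⊆ : ∀ {xs ys} → Decreasing ys → Decreasing xs → All (_∈ ys) xs → xs ⊆ ys
    decreasing-⊆ {[]}     {[]}     _  _  _        = []
    decreasing-⊆ {x ∷ xs} {[]}     _  _  (() ∷ _)
    decreasing-⊆ {[]}     {y ∷ ys} (_ ∷ ds) _ _   = y ∷ʳ decreasing-⊆ ds [] []
    decreasing-⊆ {x ∷ xs} {y ∷ ys} (_ ∷ ds) (e ∷ es) (here refl ∷ ms) =
      refl ∷ decreasing-⊆ ds es (All.zipWith (λ (y≻z , z∈) → below-tail y≻z z∈) (e , ms))
    decreasing-⊆ {x ∷ xs} {y ∷ ys} (d ∷ ds) (e ∷ es) (there x∈ ∷ ms) =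
      y ∷ʳ decreasing-⊆ ds (e ∷ es)
        (x∈ ∷ All.zipWith (λ (x≻z , z∈) → below-tail (≻-trans (All.lookup d x∈) x≻z) z∈) (e , ms))

    -- `opposite` lists the largest colour first, so that the alphabet is decreasing and each row of
    -- a symbol is a sublist of it.
    colours : ℕ → List (Colored k)
    colours ℓ = tabulate λ i → ℓ , opposite i

    letters : ℕ → List (Colored k)
    letters zero    = []
    letters (suc N) = colours N ++ letters N

    opposite-< : ∀ {n} {i j : Fin n} → i Fin.< j → opposite j Fin.< opposite i
    opposite-< {n} {i} {j} p = subst₂ ℕ._<_ (sym (Fin.opposite-prop j)) (sym (Fin.opposite-prop i))
      (ℕ.∸-monoʳ-< (ℕ.s≤s p) (Fin.toℕ<n j))

    letters-value : ∀ N → All (λ x → value x ℕ.< N) (letters N)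
    letters-value zero    = []
    letters-value (suc N) = ++⁺ (All.tabulate λ m → ℕ.≤-reflexive (cong (suc ∘ value) (proj₂ (∈-tabulate⁻ m))))
                                (All.map ℕ.m<n⇒m<1+n (letters-value N))

    letters-decreasing : ∀ N → Decreasing (letters N)
    letters-decreasing zero    = []
    letters-decreasing (suc N) = AllPairs.++⁺
      (AllPairs.tabulate⁺-< λ p → inj₂ (refl , opposite-< p))
      (letters-decreasing N)
      (All.tabulate λ m → All.map
        (λ q → inj₁ (subst (_ ℕ.<_) (sym (cong value (proj₂ (∈-tabulate⁻ m)))) q))
        (letters-value N))

    letters-complete : ∀ N x → value x ℕ.< N → x ∈ letters N
    letters-complete (suc N) (ℓ , c) p with ℓ ℕ.≟ N
    ... | yes refl = ∈-++⁺ˡ (subst (λ d → (ℓ , d) ∈ colours ℓ) (Fin.opposite-involutive c)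
                       (∈-tabulate⁺ (opposite c)))
    ... | no ℓ≢N   = ∈-++⁺ʳ (colours N) (letters-complete N (ℓ , c) (ℕ.≤∧≢⇒< (ℕ.≤-pred p) ℓ≢N))

    -- The d columns counted in the weight are charged to the top row, one per entry; hence the
    -- exponent ℓ + 1 there and ℓ below.
    topAtom botAtom : Colored k → Atom
    topAtom x = top (suc (value x))
    botAtom x = bot (value x)

    atoms : List (Colored k) → List (Colored k) → List Atom
    atoms xs ys = map topAtom xs ++ map botAtom ys

    chosenTop chosenBot : ∀ xs ys {x} → Selection (atoms xs ys) x → List (Colored k)
    chosenTop []       ys s        = []
    chosenTop (x ∷ xs) ys (inj₁ s) = chosenTop xs ys s
    chosenTop (x ∷ xs) ys (inj₂ s) = x ∷ chosenTop xs ys s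
    chosenBot []       []       s        = []
    chosenBot []       (y ∷ ys) (inj₁ s) = chosenBot [] ys s
    chosenBot []       (y ∷ ys) (inj₂ s) = y ∷ chosenBot [] ys s
    chosenBot (x ∷ xs) ys       (inj₁ s) = chosenBot xs ys s
    chosenBot (x ∷ xs) ys       (inj₂ s) = chosenBot xs ys s

    chosenTop-⊆ : ∀ xs ys {x} (s : Selection (atoms xs ys) x) → chosenTop xs ys s ⊆ xs
    chosenTop-⊆ []       ys s        = []
    chosenTop-⊆ (x ∷ xs) ys (inj₁ s) = x ∷ʳ chosenTop-⊆ xs ys s
    chosenTop-⊆ (x ∷ xs) ys (inj₂ s) = refl ∷ chosenTop-⊆ xs ys s

    chosenBot-⊆ : ∀ xs ys {x} (s : Selection (atoms xs ys) x) → chosenBot xs ys s ⊆ ys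
    chosenBot-⊆ []       []       s        = []
    chosenBot-⊆ []       (y ∷ ys) (inj₁ s) = y ∷ʳ chosenBot-⊆ [] ys s
    chosenBot-⊆ []       (y ∷ ys) (inj₂ s) = refl ∷ chosenBot-⊆ [] ys s
    chosenBot-⊆ (x ∷ xs) ys       (inj₁ s) = chosenBot-⊆ xs ys s
    chosenBot-⊆ (x ∷ xs) ys       (inj₂ s) = chosenBot-⊆ xs ys s

    -- Charge 0 says that the rows have equal length; the second component is the number being
    -- partitioned.
    total : List (Colored k) → List (Colored k) → Point
    total xs ys = + length xs - + length ys
                , + (length xs ℕ.+ (sum (map value xs) ℕ.+ sum (map value ys)))

    drop-total-top : ∀ x xs ys → drop (topAtom x) (total (x ∷ xs) ys) ≡ total xs ys
    drop-total-top x xs ys = cong₂ _,_ (ring₁ (+ length xs) (+ length ys))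
      (ring₂ (+ length xs) (+ sum (map value xs)) (+ sum (map value ys)) (+ value x))
      where
      ring₁ : ∀ a b → 1ℤ + a - b - 1ℤ ≡ a - b
      ring₁ = solve-∀
      ring₂ : ∀ a b c v → 1ℤ + (a + (v + b + c)) - (1ℤ + v) ≡ a + (b + c)
      ring₂ = solve-∀

    drop-total-bot : ∀ y xs ys → drop (botAtom y) (total xs (y ∷ ys)) ≡ total xs ys
    drop-total-bot y xs ys = cong₂ _,_ (ring₁ (+ length xs) (+ length ys))
      (ring₂ (+ length xs) (+ sum (map value xs)) (+ sum (map value ys)) (+ value y))
      where
      ring₁ : ∀ a b → a - (1ℤ + b) + 1ℤ ≡ a - b
      ring₁ = solve-∀
      ring₂ : ∀ a b c v → a + (b + (v + c)) - v ≡ a + (b + c)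
      ring₂ = solve-∀

    drop-injective : ∀ a x y → drop a x ≡ drop a y → x ≡ y
    drop-injective a (c , w) (d , v) e = cong₂ _,_
      (cancel c d (κ a) (≡-trans (sym (ch-κ a c)) (≡-trans (cong proj₁ e) (ch-κ a d))))
      (cancel w v (+ wt a) (cong proj₂ e))
      where
      cancel : ∀ c d k → c - k ≡ d - k → c ≡ d
      cancel c d k e = ≡-trans (sym (sub-add c k)) (≡-trans (cong (_+ k) e) (sub-add d k))

    chosen-total : ∀ xs ys {x} (s : Selection (atoms xs ys) x) →
                   x ≡ total (chosenTop xs ys s) (chosenBot xs ys s)
    chosen-total []       []       (refl , refl) = refl
    chosen-total []       (y ∷ ys) (inj₁ s) = chosen-total [] ys s
    chosen-total []       (y ∷ ys) (inj₂ s) = drop-injective (botAtom y) _ _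
      (≡-trans (chosen-total [] ys s) (sym (drop-total-bot y [] (chosenBot [] ys s))))
    chosen-total (x ∷ xs) ys       (inj₁ s) = chosen-total xs ys s
    chosen-total (x ∷ xs) ys       (inj₂ s) = drop-injective (topAtom x) _ _
      (≡-trans (chosen-total xs ys s) (sym (drop-total-top x (chosenTop xs ys s) (chosenBot xs ys s))))

    fresh : ∀ {x xs ys} → All (x ≻_) ys → x ∷ xs ⊆ ys → ∀ {A : Set} → A
    fresh ds p with ⊆-All p ds
    ... | d ∷ _ = ⊥-elim (≻-irrefl d)

    -- The letters are distinct, so taking a letter and skipping it never give the same sublist; at
    -- the end only equations between integers remain, which have unique proofs.
    chosen-injective : ∀ {xs ys} → Decreasing xs → Decreasing ys → ∀ {x} (s t : Selection (atoms xs ys) x) →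
      chosenTop xs ys s ≡ chosenTop xs ys t → chosenBot xs ys s ≡ chosenBot xs ys t → s ≡ t
    chosen-injective {[]} {[]} _ _ (a , b) (c , d) _ _ = cong₂ _,_ (uip a c) (uip b d)
      where open Decidable⇒UIP ℤ._≟_ renaming (≡-irrelevant to uip)
    chosen-injective {[]} {y ∷ ys} _ (d ∷ ds) (inj₁ s) (inj₁ t) e f =
      cong inj₁ (chosen-injective {[]} {ys} [] ds s t e f)
    chosen-injective {[]} {y ∷ ys} _ (d ∷ ds) (inj₂ s) (inj₂ t) e f =
      cong inj₂ (chosen-injective {[]} {ys} [] ds s t e (∷-injectiveʳ f))
    chosen-injective {[]} {y ∷ ys} _ (d ∷ ds) (inj₁ s) (inj₂ t) e f =
      fresh d (subst (_⊆ ys) f (chosenBot-⊆ [] ys s))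
    chosen-injective {[]} {y ∷ ys} _ (d ∷ ds) (inj₂ s) (inj₁ t) e f =
      fresh d (subst (_⊆ ys) (sym f) (chosenBot-⊆ [] ys t))
    chosen-injective {x ∷ xs} {ys} (d ∷ ds) es (inj₁ s) (inj₁ t) e f =
      cong inj₁ (chosen-injective {xs} {ys} ds es s t e f)
    chosen-injective {x ∷ xs} {ys} (d ∷ ds) es (inj₂ s) (inj₂ t) e f =
      cong inj₂ (chosen-injective {xs} {ys} ds es s t (∷-injectiveʳ e) f)
    chosen-injective {x ∷ xs} {ys} (d ∷ ds) es (inj₁ s) (inj₂ t) e f =
      fresh d (subst (_⊆ xs) e (chosenTop-⊆ xs ys s))
    chosen-injective {x ∷ xs} {ys} (d ∷ ds) es (inj₂ s) (inj₁ t) e f =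
      fresh d (subst (_⊆ xs) (sym e) (chosenTop-⊆ xs ys t))

    choose : ∀ {us vs xs ys} → us ⊆ xs → vs ⊆ ys → ∀ x → x ≡ total us vs →
             Σ (Selection (atoms xs ys) x) λ s → chosenTop xs ys s ≡ us × chosenBot xs ys s ≡ vs
    choose [] [] x refl = (refl , refl) , refl , refl
    choose [] (y ∷ʳ q) x e with choose [] q x e
    ... | s , refl , refl = inj₁ s , refl , refl
    choose {vs = v ∷ vs} [] (refl ∷ q) x e
      with choose [] q (drop (botAtom v) x) (≡-trans (cong (drop (botAtom v)) e) (drop-total-bot v [] vs))
    ... | s , refl , refl = inj₂ s , refl , refl
    choose (y ∷ʳ p) q x e with choose p q x e
    ... | s , refl , refl = inj₁ s , refl , refl
    choose {u ∷ us} {vs} (refl ∷ p) q x e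
      with choose p q (drop (topAtom u) x) (≡-trans (cong (drop (topAtom u)) e) (drop-total-top u us vs))
    ... | s , refl , refl = inj₂ s , refl , refl

    CFP-≡ : ∀ {n} (s t : CFP k n) → FrobeniusSymbol.top (proj₁ s) ≡ FrobeniusSymbol.top (proj₁ t) →
            FrobeniusSymbol.bottom (proj₁ s) ≡ FrobeniusSymbol.bottom (proj₁ t) → s ≡ t
    CFP-≡ (record { top-dec = d₁ ; bottom-dec = d₂ ; same-length = l } , w)
          (record { top-dec = e₁ ; bottom-dec = e₂ ; same-length = m } , v) refl refl
      rewrite Linked.irrelevant ≻-irrelevant d₁ e₁ | Linked.irrelevant ≻-irrelevant d₂ e₂
            | ℕ.≡-irrelevant l m | ℕ.≡-irrelevant w v = refl

    values≤sum : ∀ (xs : List (Colored k)) → All (λ x → value x ℕ.≤ sum (map value xs)) xs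
    values≤sum []       = []
    values≤sum (x ∷ xs) = ℕ.m≤m+n _ _ ∷ All.map (λ p → ℕ.≤-trans p (ℕ.m≤n+m _ (value x))) (values≤sum xs)

    module _ (N n : ℕ) (n<N : n ℕ.< N) where

      Chosen : Set
      Chosen = Selection (atoms (letters N) (letters N)) (0ℤ , + n)

      symbol : Chosen → CFP k n
      symbol s = record
        { top         = us
        ; bottom      = vs
        ; top-dec     = AllPairs⇒Linked (⊆-decreasing (chosenTop-⊆ (letters N) (letters N) s) (letters-decreasing N))
        ; bottom-dec  = AllPairs⇒Linked (⊆-decreasing (chosenBot-⊆ (letters N) (letters N) s) (letters-decreasing N))
        ; same-length = ℤ.+-injective (ℤ.i-j≡0⇒i≡j (+ length us) (+ length vs) (sym (cong proj₁ e)))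
        } , ℤ.+-injective (sym (cong proj₂ e))
        where
        us vs : List (Colored k)
        us = chosenTop (letters N) (letters N) s
        vs = chosenBot (letters N) (letters N) s
        e : (0ℤ , + n) ≡ total us vs
        e = chosen-total (letters N) (letters N) s

      symbol-injective : ∀ {s t} → symbol s ≡ symbol t → s ≡ t
      symbol-injective e = chosen-injective (letters-decreasing N) (letters-decreasing N) _ _
        (cong (FrobeniusSymbol.top ∘ proj₁) e) (cong (FrobeniusSymbol.bottom ∘ proj₁) e)

      symbol-surjective : ∀ y → Σ Chosen λ s → ∀ {t} → t ≡ s → symbol t ≡ y
      symbol-surjective (y , w) = proj₁ chosen ,
        λ { refl → CFP-≡ (symbol (proj₁ chosen)) (y , w) (proj₁ (proj₂ chosen)) (proj₂ (proj₂ chosen)) }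
        where
        open FrobeniusSymbol y renaming (top to us; bottom to vs)
        below : ∀ {xs} → StrictlyDecreasing xs → All (λ x → value x ℕ.≤ n) xs → xs ⊆ letters N
        below d b = decreasing-⊆ (letters-decreasing N) (Linked⇒AllPairs ≻-trans d)
          (All.map (λ p → letters-complete N _ (ℕ.≤-<-trans p n<N)) b)
        -- Every entry is at most n, hence below `N`: the truncated alphabet misses no symbol of n.
        sums : sum (map value us) ℕ.+ sum (map value vs) ℕ.≤ n
        sums = ℕ.≤-trans (ℕ.m≤n+m _ (length us)) (ℕ.≤-reflexive w)
        top-value : All (λ x → value x ℕ.≤ n) us
        top-value = All.map (λ p → ℕ.≤-trans p (ℕ.≤-trans (ℕ.m≤m+n _ _) sums)) (values≤sum us)
        bottom-value : All (λ x → value x ℕ.≤ n) vs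
        bottom-value = All.map (λ p → ℕ.≤-trans p (ℕ.≤-trans (ℕ.m≤n+m _ _) sums)) (values≤sum vs)
        e : (0ℤ , + n) ≡ total us vs
        e = cong₂ _,_ (sym (ℤ.i≡j⇒i-j≡0 (cong +_ same-length))) (cong +_ (sym w))
        chosen : Σ Chosen λ s → chosenTop (letters N) (letters N) s ≡ us × chosenBot (letters N) (letters N) s ≡ vs
        chosen = choose (below top-dec top-value) (below bottom-dec bottom-value) (0ℤ , + n) e

      count-CFP : Fin (count (atoms (letters N) (letters N)) (0ℤ , + n)) ↔ CFP k n
      count-CFP = ⤖⇒↔ (mk⤖ {to = symbol} (symbol-injective , symbol-surjective))
        ↔-∘ count-↔ (atoms (letters N) (letters N)) (0ℤ , + n)

    tabulate-replicate : ∀ m (a : Atom) → tabulate {n = m} (λ _ → a) ≡ replicate m a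
    tabulate-replicate zero    a = refl
    tabulate-replicate (suc m) a = cong (a ∷_) (tabulate-replicate m a)

    letters-tops : ∀ N → map topAtom (letters N) ≡ power k (tops N)
    letters-tops zero    = refl
    letters-tops (suc N) = ≡-trans (map-++ topAtom (colours N) (letters N)) (cong₂ _++_
      (≡-trans (map-tabulate {n = k} (λ i → N , opposite i) topAtom) (tabulate-replicate k (top (suc N))))
      (letters-tops N))

    letters-bots : ∀ N → map botAtom (letters N) ≡ power k (bots N)
    letters-bots zero    = refl
    letters-bots (suc N) = ≡-trans (map-++ botAtom (colours N) (letters N)) (cong₂ _++_
      (≡-trans (map-tabulate {n = k} (λ i → N , opposite i) botAtom) (tabulate-replicate k (bot N)))
      (letters-bots N))

  power-++ : ∀ k as bs → power k (as ++ bs) ≡ power k as ++ power k bs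
  power-++ k []       bs = refl
  power-++ k (a ∷ as) bs = ≡-trans (cong (replicate k a ++_) (power-++ k as bs))
    (sym (++-assoc (replicate k a) (power k as) (power k bs)))

  replicate-charged : ∀ k a → Charged a → All Charged (replicate k a)
  replicate-charged zero    a c = []
  replicate-charged (suc k) a c = c ∷ replicate-charged k a c

  power-charged : ∀ k {as} → All Charged as → All Charged (power k as)
  power-charged k []       = []
  power-charged k (c ∷ cs) = ++⁺ (replicate-charged k _ c) (power-charged k cs)

  factors-charged : ∀ N → All Charged (factors N)
  factors-charged N = ++⁺ (tops-charged N) (bots-charged N)

  opaque

    enumeration : ∀ k N n → n ℕ.< N →
                  Σ ℕ λ m → cφ≡ k n m × + m ≡ act (power k (factors N)) δ (0ℤ , + n)
    enumeration k N n n<N = count (atoms (letters N) (letters N)) (0ℤ , + n) , count-CFP N n n<N ,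
      ≡-trans (cong (λ as → + count as (0ℤ , + n)) atoms-power)
              (count-act (power k (factors N)) (power-charged k (factors-charged N)) (0ℤ , + n))
      where
      atoms-power : atoms {k} (letters N) (letters N) ≡ power k (factors N)
      atoms-power = ≡-trans (cong₂ _++_ (letters-tops N) (letters-bots N)) (sym (power-++ k (tops N) (bots N)))

  -- The congruences

  opaque

    tenfold-∣ : ∀ p → Tenfold p → p ℕ.∣ 10 → ∀ n → ¬ (p ℕ.∣ n) →
                Σ ℕ λ m → cφ≡ 10 n m × p ℕ.* p ℕ.∣ n ℕ.* m
    tenfold-∣ p t p∣10 n p∤n with enumeration 10 (suc n) n (ℕ.n<1+n n)
    ... | m , bijection , e = m , bijection ,
      -- One p divides the 10 of `D-power`, the other divides `h`.
      subst (p ℕ.* p ℕ.∣_) (≡-trans (sym (ℤ.abs-* (+ 10) h)) (cong ℤ.∣_∣ nm≡10h))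
        (ℕ.*-pres-∣ p∣10 (∣⇒∣ᵤ (H-offWeight t (factors-charged (suc n)) (0ℤ , + n)
          (divides 0ℤ refl , λ d → p∤n (∣⇒∣ᵤ d)))))
      where
      h : ℤ
      h = H (factors (suc n)) (0ℤ , + n)
      nm≡10h : + 10 * h ≡ + (n ℕ.* m)
      nm≡10h = sym (≡-trans (ℤ.pos-* n m) (≡-trans (cong (+ n *_) e) (D-power (factors (suc n)) (0ℤ , + n))))

  opaque

    fifteen-∣ : ∀ n → Σ ℕ λ m → cφ≡ 10 (25 ℕ.* n ℕ.+ 15) m × 5 ℕ.∣ m
    fifteen-∣ n with enumeration 10 (suc (25 ℕ.* n ℕ.+ 15)) (25 ℕ.* n ℕ.+ 15) (ℕ.n<1+n _)
    ... | m , bijection , e = m , bijection ,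
      ∣⇒∣ᵤ (subst (+ 5 ∣_) (sym (≡-trans e (at (act (power 10 (factors N)) δ) {0ℤ} refl scaled)))
        (∣-diff (act (power 10 (factors N)) δ (+ 5 • (0ℤ , w))) (act (power 2 (factors N)) δ (0ℤ , w))
          (power-dilates (factors N) (0ℤ , w))
          (two-coloured N (0ℤ , w) (refl , w<N , + n , refl))))
      where
      N : ℕ
      N = suc (25 ℕ.* n ℕ.+ 15)
      w : ℤ
      w = + 5 * + n + + 3
      ring : ∀ n → + 25 * n + + 15 ≡ + 5 * (+ 5 * n + + 3)
      ring = solve-∀
      scaled : + (25 ℕ.* n ℕ.+ 15) ≡ + 5 * w
      scaled = ≡-trans (cong (_+ + 15) (ℤ.pos-* 25 n)) (ring (+ n))
      -- One truncation serves both the tenth power at 25n + 15 and the square at 5n + 3.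
      w<N : w < + N
      w<N = subst (_< + N) (cong (_+ + 3) (ℤ.pos-* 5 n))
        (+<+ (ℕ.s≤s (ℕ.+-mono-≤ (ℕ.*-monoˡ-≤ n (ℕ.m≤m+n 5 20)) (ℕ.m≤m+n 3 12))))

  prime-square-cancel : ∀ {p} → Prime p → ∀ n m → ¬ (p ℕ.∣ n) → p ℕ.* p ℕ.∣ n ℕ.* m → p ℕ.* p ℕ.∣ m
  prime-square-cancel {p} pr n m p∤n d with euclidsLemma n m pr (ℕ.∣-trans (ℕ.m∣m*n p) d)
  ... | inj₁ p∣n = ⊥-elim (p∤n p∣n)
  ... | inj₂ (ℕ.divides q refl) with
      euclidsLemma n q pr (ℕ.*-cancelʳ-∣ p {{prime⇒nonZero pr}}
        (subst (p ℕ.* p ℕ.∣_) (sym (ℕ.*-assoc n q p)) d))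
  ...   | inj₁ p∣n = ⊥-elim (p∤n p∣n)
  ...   | inj₂ p∣q = ℕ.*-monoˡ-∣ p p∣q

  prime-square-∣ : ∀ p → Prime p → Tenfold p → p ℕ.∣ 10 → ∀ n → ¬ (p ℕ.∣ n) →
                   Σ ℕ λ m → cφ≡ 10 n m × p ℕ.* p ℕ.∣ m
  prime-square-∣ p pr t p∣10 n p∤n with tenfold-∣ p t p∣10 n p∤n
  ... | m , bijection , d = m , bijection , prime-square-cancel pr n m p∤n d

  odd-∣ : ∀ n → Σ ℕ λ m → cφ≡ 10 (2 ℕ.* n ℕ.+ 1) m × 4 ℕ.∣ m
  odd-∣ n = prime-square-∣ 2 (from-yes (prime? 2)) tenfold₂ (ℕ.divides 5 refl) (2 ℕ.* n ℕ.+ 1)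
    λ d → case-1 (ℕ.∣⇒≤ (ℕ.∣m+n∣m⇒∣n d (ℕ.m∣m*n n)))
    where
    case-1 : ¬ (2 ℕ.≤ 1)
    case-1 (ℕ.s≤s ())

  nonmultiple-∣ : ∀ n r → 1 ℕ.≤ r → r ℕ.≤ 4 → Σ ℕ λ m → cφ≡ 10 (5 ℕ.* n ℕ.+ r) m × 25 ℕ.∣ m
  nonmultiple-∣ n (suc r) _ r≤4 = prime-square-∣ 5 (from-yes (prime? 5)) tenfold₅ (ℕ.divides 2 refl) (5 ℕ.* n ℕ.+ suc r)
    λ d → ℕ.<⇒≱ (ℕ.s≤s r≤4) (ℕ.∣⇒≤ (ℕ.∣m+n∣m⇒∣n d (ℕ.m∣m*n n)))

open import Data.Nat using (ℕ; _+_; _*_; _≤_)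
open import Data.Nat.Divisibility using (_∣_)
open import Data.Product using (Σ; _×_; _,_)

theorem6p6 : (∀ n → Σ ℕ (λ m → cφ≡ 10 (2 * n + 1) m × 4 ∣ m))
    × (∀ n r → 1 ≤ r → r ≤ 4 → Σ ℕ (λ m → cφ≡ 10 (5 * n + r) m × 25 ∣ m))
    × (∀ n → Σ ℕ (λ m → cφ≡ 10 (25 * n + 15) m × 5 ∣ m))
theorem6p6 = LaurentSeries.odd-∣ , LaurentSeries.nonmultiple-∣ , LaurentSeries.fifteen-∣
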